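{- Let $m\ge1$, $0\le s\le m$, and let $\underline r=(r_0,\dots,r_s)$ be a composition of $m+1$ into $s+1$ positive parts. For every set $X$, the image $\mathbb F_{\underline r}(\mathrm{Dyck}^m(X))$ of the free $\mathrm{Dyck}^m$ algebra on $X$ is a free $\mathrm{Dyck}^s$ algebra.
   Context: A $\mathrm{Dyck}^l$ algebra ($l\ge0$): vector space with bilinear $*_0,\dots,*_l$ such that $x*_i(y*_jz)=(x*_iy)*_jz$ for $0\le i<j\le l$ and $\sum_{j=0}^ix*_i(y*_jz)=\sum_{k=i}^l(x*_ky)*_iz$ for $0\le i\le l$ (for $l=0$: associative algebras). $\mathrm{Dyck}^m(X)$ is the free $\mathrm{Dyck}^m$ algebra on $X$. For a composition $\underline r=(r_0,\dots,r_s)$ of $m+1$, with $R_i=r_0+\dots+r_{i-1}$ ($R_0=0$), $\mathbb F_{\underline r}$ sends a $\mathrm{Dyck}^m$ algebra $(D,*_0,\dots,*_m)$ to the $\mathrm{Dyck}^s$ algebra $(D,\overline*_0,\dots,\overline*_s)$ with $x\,\overline*_i\,y=\sum_{j=R_i}^{R_{i+1}-1}x*_jy$. -}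

module Defs where

open import Level using (Level; _⊔_) renaming (suc to lsuc)
open import Data.Nat using (ℕ; zero; suc; _∸_; _<_; _<?_)
open import Data.Fin using (Fin; toℕ; fromℕ<)
open import Data.List using (List; take)
open import Data.Nat.ListAction using (sum)
open import Data.Product using (Σ; _×_; _,_)
open import Relation.Nullary using (¬_; yes; no)
open import Algebra.Bundles using (CommutativeRing)
open import Algebra.Module.Bundles using (Module)

record Field (c ℓ : Level) : Set (lsuc (c ⊔ ℓ)) where
  field
    commutativeRing : CommutativeRing c ℓ
  open CommutativeRing commutativeRing public
  field
    1≉0     : ¬ (1# ≈ 0#)
    inverse : ∀ x → ¬ (x ≈ 0#) → Σ Carrier (λ y → (x * y) ≈ 1#)

module _ {c ℓ : Level} (K : Field c ℓ) where

  open Field K using (commutativeRing)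

  record DyckStr (l : ℕ) (a ℓa : Level) : Set (c ⊔ ℓ ⊔ lsuc (a ⊔ ℓa)) where
    field
      vecSpace : Module commutativeRing a ℓa
      op       : Fin (suc l) → Module.Carrierᴹ vecSpace →
                 Module.Carrierᴹ vecSpace → Module.Carrierᴹ vecSpace
    open Module vecSpace public

    -- *_j indexed by a natural number j (0 when j > l; never used out of range)
    opℕ : ℕ → Carrierᴹ → Carrierᴹ → Carrierᴹ
    opℕ j x y with j <? suc l
    ... | yes j<  = op (fromℕ< j<) x y
    ... | no  _   = 0ᴹ

    sumFrom : ℕ → ℕ → (ℕ → Carrierᴹ) → Carrierᴹ
    sumFrom a zero    f = 0ᴹ
    sumFrom a (suc n) f = f a +ᴹ sumFrom (suc a) n f

    sumRange : ℕ → ℕ → (ℕ → Carrierᴹ) → Carrierᴹ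
    sumRange a b f = sumFrom a (b ∸ a) f

  record IsDyckAlgebra {l : ℕ} {a ℓa : Level} (D : DyckStr l a ℓa)
         : Set (c ⊔ a ⊔ ℓa) where
    open DyckStr D
    open Field K using () renaming (Carrier to Kc)
    field
      op-cong : ∀ i {x x′ y y′} → x ≈ᴹ x′ → y ≈ᴹ y′ → op i x y ≈ᴹ op i x′ y′
      op-+ˡ   : ∀ i x x′ y → op i (x +ᴹ x′) y ≈ᴹ (op i x y +ᴹ op i x′ y)
      op-+ʳ   : ∀ i x y y′ → op i x (y +ᴹ y′) ≈ᴹ (op i x y +ᴹ op i x y′)
      op-*ˡ   : ∀ i (k : Kc) x y → op i (k *ₗ x) y ≈ᴹ (k *ₗ op i x y)
      op-*ʳ   : ∀ i (k : Kc) x y → op i x (k *ₗ y) ≈ᴹ (k *ₗ op i x y)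
      dyck₁   : ∀ (i j : Fin (suc l)) → toℕ i < toℕ j → ∀ x y z →
                op i x (op j y z) ≈ᴹ op j (op i x y) z
      dyck₂   : ∀ (i : Fin (suc l)) x y z →
                sumRange 0 (suc (toℕ i)) (λ j → op i x (opℕ j y z))
                  ≈ᴹ sumRange (toℕ i) (suc l) (λ k → op i (opℕ k x y) z)

  record Hom {l : ℕ} {a ℓa b ℓb : Level}
             (A : DyckStr l a ℓa) (B : DyckStr l b ℓb)
             : Set (c ⊔ a ⊔ ℓa ⊔ b ⊔ ℓb) where
    private
      module A = DyckStr A
      module B = DyckStr B
    open Field K using () renaming (Carrier to Kc)
    field
      fun    : A.Carrierᴹ → B.Carrierᴹ
      cong   : ∀ {x y} → x A.≈ᴹ y → fun x B.≈ᴹ fun y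
      +-hom  : ∀ x y → fun (x A.+ᴹ y) B.≈ᴹ (fun x B.+ᴹ fun y)
      *ₗ-hom : ∀ (k : Kc) x → fun (k A.*ₗ x) B.≈ᴹ (k B.*ₗ fun x)
      op-hom : ∀ i x y → fun (A.op i x y) B.≈ᴹ B.op i (fun x) (fun y)

  IsFree : {l : ℕ} {a ℓa : Level} (A : DyckStr l a ℓa) (X : Set a)
           (ι : X → DyckStr.Carrierᴹ A) → Set (c ⊔ ℓ ⊔ lsuc (a ⊔ ℓa))
  IsFree {l} {a} {ℓa} A X ι =
    ∀ (B : DyckStr l a ℓa) → IsDyckAlgebra B → (f : X → DyckStr.Carrierᴹ B) →
    Σ (Hom A B) λ g →
      (∀ x → DyckStr._≈ᴹ_ B (Hom.fun g (ι x)) (f x)) ×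
      (∀ (h : Hom A B) → (∀ x → DyckStr._≈ᴹ_ B (Hom.fun h (ι x)) (f x)) →
         ∀ y → DyckStr._≈ᴹ_ B (Hom.fun h y) (Hom.fun g y))

  partialSum : List ℕ → ℕ → ℕ
  partialSum r i = sum (take i r)

  F : {m : ℕ} {a ℓa : Level} (s : ℕ) (r : List ℕ) →
      DyckStr m a ℓa → DyckStr s a ℓa
  F s r D = record
    { vecSpace = vecSpace
    ; op = λ i x y → sumRange (partialSum r (toℕ i)) (partialSum r (suc (toℕ i)))
                              (λ j → opℕ j x y)
    }
    where open DyckStr D

module Submission where

-- Put x ⊙ₖ y = Σ_{j ≥ k} x *ⱼ y. In these operations the Dyckᵐ axioms become
--   (x ⊙ᵢ y) ⊙ₖ z = x ⊙ᵢ (y ⊙ₖ z) + x ⊙ₖ (y ⊙₀ z − y ⊙ₖ z)   for i ≤ k ≤ m,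
-- and 𝔽_r just keeps ⊙_{R₀}, …, ⊙_{R_s}. Rewriting with these identities from left to right,
-- the free algebra on X over ℤ has as basis the trees (…((x ⊙_{j₁} t₁) ⊙_{j₂} t₂) …) with j₁ > j₂ > … .
-- Forgetting a single ⊙_q with q ≥ 1 leaves a free algebra on the generators x ∈ X and u ⊙_q h, where all
-- operations on the left spine of u are > q and h is built using right combs u ⊙ⱼ h′ with j ≤ q only.
-- Forgetting the unwanted operations in decreasing order gives the theorem over ℤ.
--
-- The levels of K are unrelated to those of D, so K-linear combinations of trees need not form a vector
-- space to which the universal property of D applies. Instead, every function φ from trees to a vector
-- space W is extended linearly to D: if φ is supported on trees of size ≤ n + 1, then
-- (d , w) (d′ , w′) ↦ (d ⊙ₖ d′ , βₖ d d′) makes D × W an algebra, where βₖ extends (t , t′) ↦ φ (t ⊙ₖ t′) one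
-- variable at a time by induction on n, and the extension of φ is the second component of D → D × W.

-- The relation between `⊙ᵢ` and `⊙ₖ` involves no subscripts besides i, k and 0, so every set of
-- these operations that contains `⊙₀` satisfies the same axioms. The obstacle in forgetting `⊙_q`
-- is evaluation: a target algebra has no `⊙_q`, so u ⊙_q v must first be brought to the chosen
-- generators. For k > q the relation is read backwards, u ⊙_q (v ⊙ₖ w) = (u ⊙_q v) ⊙ₖ w - u ⊙ₖ (v
-- ⊙₀ w - v ⊙ₖ w), which moves large operations out of the right factor. Such moves nest inside u₁ ⊙
-- (u₂ ⊙ ...); right modules, enlarged at each level, turn the nest into a structural recursion.
--
-- Extending functions φ of bounded support yields projections pₙ of D onto the span of the trees of
-- size ≤ n. The pairs (n , d), read as pₙ d, form an algebra at the levels of D, to which the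
-- universal property does apply; it shows that every d equals pₙ d for some n. Hence an arbitrary φ
-- extends to D by taking n large, and linear maps on D are determined by their values on trees.

open import Defs
open import Level using (Level; _⊔_) renaming (suc to lsuc)
open import Algebra.Bundles using (AbelianGroup)
import Algebra.Construct.DirectProduct as DP
open import Algebra.Module.Bundles using (Module)
open import Algebra.Module.Bundles.Raw using (RawModule)
import Algebra.Module.Construct.DirectProduct as MDP
open import Algebra.Module.Morphism.Structures using (IsModuleMonomorphism)
import Algebra.Module.Morphism.ModuleMonomorphism as ModuleMonomorphism
open import Data.Empty using (⊥-elim)
open import Data.Fin as Fin using (Fin; zero; suc; toℕ; fromℕ<)
import Data.Fin.Properties as Finₚ
open import Data.List using (List; []; _∷_; length; take)
open import Data.List.Relation.Unary.All using (All; []; _∷_)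
open import Data.Nat as ℕ using (ℕ; zero; suc; _∸_; _≤_; _<_; z≤n; s≤s; _<?_; _≤?_)
import Data.Nat.Properties as ℕₚ
open import Data.Nat.ListAction using (sum)
open import Data.Product using (Σ; _×_; _,_; proj₁; proj₂)
open import Data.Sum using (_⊎_; inj₁; inj₂)
open import Data.Unit.Polymorphic using (⊤; tt)
open import Data.Vec using (Vec; []; _∷_; lookup; zipWith; replicate; updateAt)
open import Relation.Binary.Definitions using (tri<; tri≈; tri>)
open import Relation.Binary.PropositionalEquality as ≡ using (_≡_; _≢_)
open import Relation.Nullary using (yes; no; Dec)

-- Linear identities in abelian groups, decided by comparing coefficients

infixl 6 _⊕_ _⊝_

data Expr (n : ℕ) : Set where
  var : Fin n → Expr n
  ze  : Expr n
  _⊕_ _⊝_ : Expr n → Expr n → Expr n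

pattern v0 = var zero
pattern v1 = var (suc zero)
pattern v2 = var (suc (suc zero))
pattern v3 = var (suc (suc (suc zero)))
pattern v4 = var (suc (suc (suc (suc zero))))

unit : ∀ {n} → Fin n → Vec ℕ n
unit i = updateAt (replicate _ 0) i (λ _ → 1)

_⊞_ : ∀ {n} → Vec ℕ n → Vec ℕ n → Vec ℕ n
_⊞_ = zipWith ℕ._+_

-- Positive and negative occurrences are counted apart, so that coefficients stay in ℕ and are
-- compared by closed computation.
pos neg : ∀ {n} → Expr n → Vec ℕ n
pos (var i) = unit i
pos ze      = replicate _ 0
pos (e ⊕ f) = pos e ⊞ pos f
pos (e ⊝ f) = pos e ⊞ neg f
neg (var i) = replicate _ 0
neg ze      = replicate _ 0
neg (e ⊕ f) = neg e ⊞ neg f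
neg (e ⊝ f) = neg e ⊞ pos f

module Ab {g ℓ} (G : AbelianGroup g ℓ) where

  open AbelianGroup G public using (Carrier; _≈_; setoid; refl; sym; trans; reflexive)
    renaming ( _∙_ to infixl 6 _+_ ; ε to 0# ; _⁻¹ to infix 8 -_
             ; ∙-cong to +-cong ; assoc to +-assoc ; comm to +-comm
             ; identityˡ to +-identityˡ ; identityʳ to +-identityʳ
             ; inverseˡ to -‿inverseˡ ; inverseʳ to -‿inverseʳ ; ⁻¹-cong to -‿cong)
  open AbelianGroup G using (isEquivalence; commutativeMonoid; monoid; group)
  open import Relation.Binary.Reasoning.Setoid setoid public
  open import Algebra.Properties.Monoid.Mult monoid using (×-homo-+) renaming (_×_ to _·_)
  open import Algebra.Properties.Group group public using () renaming (∙-cancelʳ to +-cancelʳ)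
  open import Algebra.Properties.AbelianGroup G public using () renaming (⁻¹-∙-comm to -‿+-comm)
  open import Algebra.Properties.CommutativeSemigroup (AbelianGroup.commutativeSemigroup G)
    using () renaming (interchange to +-interchange) public

  infixl 6 _-_
  _-_ : Carrier → Carrier → Carrier
  x - y = x + (- y)

  sub-cong : ∀ {x x′ y y′} → x ≈ x′ → y ≈ y′ → x - y ≈ x′ - y′
  sub-cong p q = +-cong p (-‿cong q)

  ⟦_⟧ : ∀ {n} → Expr n → Vec Carrier n → Carrier
  ⟦ var i ⟧ ρ = lookup ρ i
  ⟦ ze ⟧ ρ    = 0#
  ⟦ e ⊕ f ⟧ ρ = ⟦ e ⟧ ρ + ⟦ f ⟧ ρ
  ⟦ e ⊝ f ⟧ ρ = ⟦ e ⟧ ρ - ⟦ f ⟧ ρ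

  private
    comb : ∀ {n} → Vec ℕ n → Vec Carrier n → Carrier
    comb [] []             = 0#
    comb (k ∷ ks) (x ∷ ρ) = (k · x) + comb ks ρ

    comb-0 : ∀ {n} (ρ : Vec Carrier n) → comb (replicate _ 0) ρ ≈ 0#
    comb-0 []      = refl
    comb-0 (x ∷ ρ) = trans (+-identityˡ _) (comb-0 ρ)

    comb-⊞ : ∀ {n} (p q : Vec ℕ n) ρ → comb (p ⊞ q) ρ ≈ comb p ρ + comb q ρ
    comb-⊞ [] [] []                  = sym (+-identityˡ _)
    comb-⊞ (k ∷ p) (l ∷ q) (x ∷ ρ) =
      trans (+-cong (×-homo-+ x k l) (comb-⊞ p q ρ)) (+-interchange _ _ _ _)

    comb-unit : ∀ {n} (i : Fin n) ρ → comb (unit i) ρ ≈ lookup ρ i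
    comb-unit zero (x ∷ ρ)    = trans (+-cong (+-identityʳ x) (comb-0 ρ)) (+-identityʳ x)
    comb-unit (suc i) (x ∷ ρ) = trans (+-identityˡ _) (comb-unit i ρ)

  x-y+y≈x : ∀ x y → (x - y) + y ≈ x
  x-y+y≈x x y = trans (+-assoc _ _ _) (trans (+-cong refl (-‿inverseˡ y)) (+-identityʳ x))

  private
    correct : ∀ {n} (e : Expr n) ρ → ⟦ e ⟧ ρ + comb (neg e) ρ ≈ comb (pos e) ρ
    correct (var i) ρ = trans (+-cong refl (comb-0 ρ)) (trans (+-identityʳ _) (sym (comb-unit i ρ)))
    correct ze ρ      = +-identityˡ _
    correct (e ⊕ f) ρ = begin
      (⟦ e ⟧ ρ + ⟦ f ⟧ ρ) + comb (neg e ⊞ neg f) ρ          ≈⟨ +-cong refl (comb-⊞ (neg e) (neg f) ρ) ⟩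
      (⟦ e ⟧ ρ + ⟦ f ⟧ ρ) + (comb (neg e) ρ + comb (neg f) ρ) ≈⟨ +-interchange _ _ _ _ ⟩
      _                                                      ≈⟨ +-cong (correct e ρ) (correct f ρ) ⟩
      comb (pos e) ρ + comb (pos f) ρ                        ≈⟨ comb-⊞ (pos e) (pos f) ρ ⟨
      comb (pos e ⊞ pos f) ρ ∎
    correct (e ⊝ f) ρ = begin
      (⟦ e ⟧ ρ - ⟦ f ⟧ ρ) + comb (neg e ⊞ pos f) ρ          ≈⟨ +-cong refl (comb-⊞ (neg e) (pos f) ρ) ⟩
      (⟦ e ⟧ ρ - ⟦ f ⟧ ρ) + (comb (neg e) ρ + comb (pos f) ρ) ≈⟨ +-interchange _ _ _ _ ⟩
      (⟦ e ⟧ ρ + comb (neg e) ρ) + (- ⟦ f ⟧ ρ + comb (pos f) ρ)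
        ≈⟨ +-cong (correct e ρ) (trans (+-cong refl (sym (correct f ρ)))
             (trans (sym (+-assoc _ _ _)) (trans (+-cong (-‿inverseˡ _) refl) (+-identityˡ _)))) ⟩
      comb (pos e) ρ + comb (neg f) ρ                        ≈⟨ comb-⊞ (pos e) (neg f) ρ ⟨
      comb (pos e ⊞ neg f) ρ ∎

  abstract
   -- Equality of the integer coefficients pos - neg is stated crosswise. By `correct`, both sides
   -- agree after adding the same combination `comb (neg e ⊞ neg f) ρ`, which is then cancelled.
   solve : ∀ {n} (e f : Expr n) → pos e ⊞ neg f ≡ pos f ⊞ neg e →
           (ρ : Vec Carrier n) → ⟦ e ⟧ ρ ≈ ⟦ f ⟧ ρ
   solve e f eq ρ = +-cancelʳ (comb (neg e ⊞ neg f) ρ) _ _ (begin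
       ⟦ e ⟧ ρ + comb (neg e ⊞ neg f) ρ             ≈⟨ side e f ⟩
       comb (pos e ⊞ neg f) ρ                        ≡⟨ ≡.cong (λ p → comb p ρ) eq ⟩
       comb (pos f ⊞ neg e) ρ                        ≈⟨ side f e ⟨
       ⟦ f ⟧ ρ + comb (neg f ⊞ neg e) ρ
         ≈⟨ +-cong refl (trans (comb-⊞ (neg f) (neg e) ρ) (trans (+-comm _ _) (sym (comb-⊞ (neg e) (neg f) ρ)))) ⟩
       ⟦ f ⟧ ρ + comb (neg e ⊞ neg f) ρ ∎)
     where
     side : ∀ e f → ⟦ e ⟧ ρ + comb (neg e ⊞ neg f) ρ ≈ comb (pos e ⊞ neg f) ρ
     side e f = begin
       ⟦ e ⟧ ρ + comb (neg e ⊞ neg f) ρ               ≈⟨ +-cong refl (comb-⊞ (neg e) (neg f) ρ) ⟩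
       ⟦ e ⟧ ρ + (comb (neg e) ρ + comb (neg f) ρ)     ≈⟨ +-assoc _ _ _ ⟨
       ⟦ e ⟧ ρ + comb (neg e) ρ + comb (neg f) ρ       ≈⟨ +-cong (correct e ρ) refl ⟩
       comb (pos e) ρ + comb (neg f) ρ                 ≈⟨ comb-⊞ (pos e) (neg f) ρ ⟨
       comb (pos e ⊞ neg f) ρ ∎

  ≈-from-0 : ∀ {x y} → x - y ≈ 0# → x ≈ y
  ≈-from-0 {x} {y} p = trans (sym (x-y+y≈x x y)) (trans (+-cong p refl) (+-identityˡ y))

record Additive {g ℓ h ℓ′} (G : AbelianGroup g ℓ) (H : AbelianGroup h ℓ′)
                (f : AbelianGroup.Carrier G → AbelianGroup.Carrier H) : Set (g ⊔ ℓ ⊔ h ⊔ ℓ′) where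
  no-eta-equality
  private
    module G = Ab G
    module H = Ab H
  field
    f-cong : ∀ {x y} → x G.≈ y → f x H.≈ f y
    f-+    : ∀ x y → f (x G.+ y) H.≈ f x H.+ f y

  f-0 : f G.0# H.≈ H.0#
  f-0 = H.+-cancelʳ (f G.0#) _ _
          (H.trans (H.sym (f-+ _ _)) (H.trans (f-cong (G.+-identityˡ _)) (H.sym (H.+-identityˡ _))))

  f-neg : ∀ x → f (G.- x) H.≈ H.- f x
  f-neg x = H.+-cancelʳ (f x) _ _
              (H.trans (H.sym (f-+ _ _)) (H.trans (f-cong (G.-‿inverseˡ _))
                (H.trans f-0 (H.sym (H.-‿inverseˡ _)))))

  f-sub : ∀ x y → f (x G.- y) H.≈ f x H.- f y
  f-sub x y = H.trans (f-+ _ _) (H.+-cong H.refl (f-neg y))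

-- Free abelian groups, and the free algebra on trees

module FreeAbelian {a} (T : Set a) where

  infix 4 _≋_

  -- Formal terms modulo `_≋_`; sums are never normalised. Maps out are built by `lift` and compared
  -- on generators by `additive-ext`, while predicates such as `Sized` inspect the chosen term.
  data FA : Set a where
    gen  : T → FA
    zer  : FA
    plus : FA → FA → FA
    inv  : FA → FA

  data _≋_ : FA → FA → Set a where
    ≋-refl  : ∀ {x} → x ≋ x
    ≋-sym   : ∀ {x y} → x ≋ y → y ≋ x
    ≋-trans : ∀ {x y z} → x ≋ y → y ≋ z → x ≋ z
    plus-cong  : ∀ {x x′ y y′} → x ≋ x′ → y ≋ y′ → plus x y ≋ plus x′ y′
    inv-cong   : ∀ {x x′} → x ≋ x′ → inv x ≋ inv x′
    plus-assoc : ∀ x y z → plus (plus x y) z ≋ plus x (plus y z)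
    plus-comm  : ∀ x y → plus x y ≋ plus y x
    plus-zer   : ∀ x → plus x zer ≋ x
    plus-inv   : ∀ x → plus x (inv x) ≋ zer

  FAgroup : AbelianGroup a a
  FAgroup = record
    { Carrier = FA ; _≈_ = _≋_ ; _∙_ = plus ; ε = zer ; _⁻¹ = inv
    ; isAbelianGroup = record
      { isGroup = record
        { isMonoid = record
          { isSemigroup = record
            { isMagma = record
              { isEquivalence = record { refl = ≋-refl ; sym = ≋-sym ; trans = ≋-trans }
              ; ∙-cong = plus-cong }
            ; assoc = plus-assoc }
          ; identity = (λ x → ≋-trans (plus-comm _ _) (plus-zer x)) , plus-zer }
        ; inverse = (λ x → ≋-trans (plus-comm _ _) (plus-inv x)) , plus-inv
        ; ⁻¹-cong = inv-cong }
      ; comm = plus-comm } }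
    where open import Data.Product using (_,_)

  module _ {g ℓ} (G : AbelianGroup g ℓ) where
    open Ab G

    lift : (T → Carrier) → FA → Carrier
    lift φ (gen t)    = φ t
    lift φ zer        = 0#
    lift φ (plus m n) = lift φ m + lift φ n
    lift φ (inv m)    = - lift φ m

    lift-cong : ∀ φ {m n} → m ≋ n → lift φ m ≈ lift φ n
    lift-cong φ ≋-refl             = refl
    lift-cong φ (≋-sym p)          = sym (lift-cong φ p)
    lift-cong φ (≋-trans p q)      = trans (lift-cong φ p) (lift-cong φ q)
    lift-cong φ (plus-cong p q)    = +-cong (lift-cong φ p) (lift-cong φ q)
    lift-cong φ (inv-cong p)       = -‿cong (lift-cong φ p)
    lift-cong φ (plus-assoc x y z) = +-assoc _ _ _
    lift-cong φ (plus-comm x y)    = +-comm _ _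
    lift-cong φ (plus-zer x)       = +-identityʳ _
    lift-cong φ (plus-inv x)       = -‿inverseʳ _

    lift-additive : ∀ φ → Additive FAgroup G (lift φ)
    lift-additive φ = record { f-cong = lift-cong φ ; f-+ = λ _ _ → refl }

    additive-ext : ∀ {f f′} → Additive FAgroup G f → Additive FAgroup G f′ →
                   (∀ t → f (gen t) ≈ f′ (gen t)) → ∀ m → f m ≈ f′ m
    additive-ext F F′ e (gen t)    = e t
    additive-ext F F′ e zer        = trans (Additive.f-0 F) (sym (Additive.f-0 F′))
    additive-ext F F′ e (plus m n) = trans (Additive.f-+ F m n)
      (trans (+-cong (additive-ext F F′ e m) (additive-ext F F′ e n)) (sym (Additive.f-+ F′ m n)))
    additive-ext F F′ e (inv m)    = trans (Additive.f-neg F m)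
      (trans (-‿cong (additive-ext F F′ e m)) (sym (Additive.f-neg F′ m)))

additive-∘ : ∀ {a b c ℓa ℓb ℓc} {A : AbelianGroup a ℓa} {B : AbelianGroup b ℓb} {C : AbelianGroup c ℓc}
             {g f} → Additive B C g → Additive A B f → Additive A C (λ x → g (f x))
additive-∘ {C = C} G F = record
  { f-cong = λ p → Additive.f-cong G (Additive.f-cong F p)
  ; f-+    = λ x y → AbelianGroup.trans C (Additive.f-cong G (Additive.f-+ F x y)) (Additive.f-+ G _ _) }

additive-0 : ∀ {a b ℓa ℓb} {A : AbelianGroup a ℓa} {B : AbelianGroup b ℓb} →
             Additive A B (λ _ → AbelianGroup.ε B)
additive-0 {B = B} = record { f-cong = λ _ → refl ; f-+ = λ _ _ → sym (+-identityˡ _) }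
  where open Ab B

additive-+ : ∀ {a b ℓa ℓb} {A : AbelianGroup a ℓa} {B : AbelianGroup b ℓb} {g f} →
             Additive A B g → Additive A B f → Additive A B (λ x → AbelianGroup._∙_ B (g x) (f x))
additive-+ {B = B} G F = record
  { f-cong = λ p → +-cong (Additive.f-cong G p) (Additive.f-cong F p)
  ; f-+    = λ x y → trans (+-cong (Additive.f-+ G x y) (Additive.f-+ F x y)) (+-interchange _ _ _ _) }
  where open Ab B

additive-sub : ∀ {a b ℓa ℓb} {A : AbelianGroup a ℓa} {B : AbelianGroup b ℓb} {g f} →
             Additive A B g → Additive A B f → Additive A B (λ x → Ab._-_ B (g x) (f x))
additive-sub {B = B} G F = record
  { f-cong = λ p → sub-cong (Additive.f-cong G p) (Additive.f-cong F p)
  ; f-+    = λ x y → trans (sub-cong (Additive.f-+ G x y) (Additive.f-+ F x y))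
                           (solve ((v0 ⊕ v1) ⊝ (v2 ⊕ v3)) ((v0 ⊝ v2) ⊕ (v1 ⊝ v3)) ≡.refl (_ ∷ _ ∷ _ ∷ _ ∷ [])) }
  where open Ab B

-- Algebras in the operations ⊙ of given ranks, and the algebra of trees

record Index : Set₁ where
  field
    I  : Set
    ρ  : I → ℕ
    o  : I
    ρo : ρ o ≡ 0
  o-min : ∀ k → ρ o ≤ ρ k
  o-min k = ≡.subst (_≤ ρ k) (≡.sym ρo) z≤n

-- The rank `ρ i` is the original subscript of ⊙. Ranks may have gaps, so the same record describes
-- an algebra before and after operations are forgotten.
record Alg (𝕀 : Index) (b ℓ : Level) : Set (lsuc (b ⊔ ℓ)) where
  no-eta-equality
  open Index 𝕀
  field
    group : AbelianGroup b ℓ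
  open Ab group public
  field
    op      : I → Carrier → Carrier → Carrier
    op-cong : ∀ i {x x′ y y′} → x ≈ x′ → y ≈ y′ → op i x y ≈ op i x′ y′
    op-+ˡ   : ∀ i x x′ y → op i (x + x′) y ≈ op i x y + op i x′ y
    op-+ʳ   : ∀ i x y y′ → op i x (y + y′) ≈ op i x y + op i x y′

  co : I → Carrier → Carrier → Carrier
  co k x y = op o x y - op k x y

  field
    rel : ∀ {i k} → ρ i ≤ ρ k → ∀ x y z → op k (op i x y) z ≈ op i x (op k y z) + op k x (co k y z)

  opˡ : ∀ i y → Additive group group (λ x → op i x y)
  opˡ i y = record { f-cong = λ p → op-cong i p refl ; f-+ = λ x x′ → op-+ˡ i x x′ y }

  opʳ : ∀ i x → Additive group group (op i x)
  opʳ i x = record { f-cong = op-cong i refl ; f-+ = op-+ʳ i x }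

  co-cong : ∀ i {x x′ y y′} → x ≈ x′ → y ≈ y′ → co i x y ≈ co i x′ y′
  co-cong i p q = sub-cong (op-cong o p q) (op-cong i p q)

  coˡ : ∀ i y → Additive group group (λ x → co i x y)
  coˡ i y = additive-sub (opˡ o y) (opˡ i y)

  coʳ : ∀ i x → Additive group group (co i x)
  coʳ i x = additive-sub (opʳ o x) (opʳ i x)

module Trees (𝕀 : Index) {a} (X : Set a) where
  open Index 𝕀

  -- app j u v stands for u ⊙ⱼ v; the index b of T b is a lower bound for the root operation.
  data T (b : ℕ) : Set a where
    leaf : X → T b
    app  : (j : I) → b ≤ ρ j → T (suc (ρ j)) → T 0 → T b

  wk : ∀ {b} → T b → T 0
  wk (leaf x)      = leaf x
  wk (app j _ u v) = app j z≤n u v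

  wk-id : (t : T 0) → wk t ≡ t
  wk-id (leaf x)        = ≡.refl
  wk-id (app j z≤n u v) = ≡.refl

  open FreeAbelian (T 0) public
  open Ab FAgroup

  mapApp : (k : I) → T (suc (ρ k)) → FA → FA
  mapApp k u = lift FAgroup (λ v → gen (app k z≤n u v))

  -- The rewriting rule for (u ⊙ⱼ v) ⊙ₖ d only multiplies by `u` and `v` on the left. Allowing an
  -- arbitrary sum `d` on the right therefore makes this a structural recursion on the left factor.
  mul : ∀ {b} → I → T b → FA → FA
  mul k (leaf x) d = mapApp k (leaf x) d
  mul k (app j _ u v) d with suc (ρ k) ≤? ρ j
  ... | yes lt = mapApp k (app j lt u v) d
  ... | no  _  = mul j u (mul k v d) + mul k u (mul o v d - mul k v d)

  module _ {b} {k j : I} {le : b ≤ ρ j} {u : T (suc (ρ j))} {v : T 0} where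

    mul-lt : (lt : ρ k < ρ j) → ∀ d → mul k (app {b} j le u v) d ≡ mapApp k (app j lt u v) d
    mul-lt lt d with suc (ρ k) ≤? ρ j
    ... | yes lt′ = ≡.cong (λ p → mapApp k (app j p u v) d) (ℕₚ.≤-irrelevant lt′ lt)
    ... | no ¬lt  = ⊥-elim (¬lt lt)

    mul-ge : ρ j ≤ ρ k → ∀ d →
             mul k (app {b} j le u v) d ≡ mul j u (mul k v d) + mul k u (mul o v d - mul k v d)
    mul-ge ge d with suc (ρ k) ≤? ρ j
    ... | yes lt = ⊥-elim (ℕₚ.<⇒≱ lt ge)
    ... | no _   = ≡.refl

  mul-bound : ∀ {b c j} {u : T (suc (ρ j))} {v : T 0} k (le : b ≤ ρ j) (le′ : c ≤ ρ j) d →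
              mul k (app j le u v) d ≡ mul k (app j le′ u v) d
  mul-bound {j = j} k le le′ d with suc (ρ k) ≤? ρ j
  ... | yes lt = ≡.refl
  ... | no _   = ≡.refl

  mul-nf : ∀ {k} (u : T (suc (ρ k))) d → mul k u d ≡ mapApp k u d
  mul-nf (leaf x) d         = ≡.refl
  mul-nf (app j lt u v) d   = mul-lt {le = lt} lt d

  mul-additive : ∀ {b} k (t : T b) → Additive FAgroup FAgroup (mul k t)
  mul-additive k (leaf x) = lift-additive FAgroup _
  mul-additive k (app j _ u v) with suc (ρ k) ≤? ρ j
  ... | yes lt = lift-additive FAgroup _
  ... | no  _  = additive-+ (additive-∘ (mul-additive j u) (mul-additive k v))
                   (additive-∘ (mul-additive k u) (additive-sub (mul-additive o v) (mul-additive k v)))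

  infixl 7 _⊙⟨_⟩_
  _⊙⟨_⟩_ : FA → I → FA → FA
  m ⊙⟨ k ⟩ d = lift FAgroup (λ t → mul k t d) m

  ⊙-additiveˡ : ∀ k d → Additive FAgroup FAgroup (λ m → m ⊙⟨ k ⟩ d)
  ⊙-additiveˡ k d = lift-additive FAgroup _

  ⊙-additiveʳ : ∀ k m → Additive FAgroup FAgroup (λ d → m ⊙⟨ k ⟩ d)
  ⊙-additiveʳ k (gen t)    = mul-additive k t
  ⊙-additiveʳ k zer        = additive-0
  ⊙-additiveʳ k (plus m n) = additive-+ (⊙-additiveʳ k m) (⊙-additiveʳ k n)
  ⊙-additiveʳ k (inv m)    = record
    { f-cong = λ p → -‿cong (f-cong p)
    ; f-+    = λ x y → trans (-‿cong (f-+ x y)) (sym (-‿+-comm _ _)) }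
    where open Additive (⊙-additiveʳ k m)

  private
    coM : I → FA → FA → FA
    coM k y z = y ⊙⟨ o ⟩ z - y ⊙⟨ k ⟩ z

    Rel : ∀ {b} → I → I → T b → Set a
    Rel i k t = ∀ y z → mul i t y ⊙⟨ k ⟩ z ≈ mul i t (y ⊙⟨ k ⟩ z) + mul k t (coM k y z)

    -- For a tree v the product of `app i z≤n u v` with `z` is computed by exactly this rule;
    -- additivity in `y` does the rest.
    mapApp-rel : ∀ {i k} → ρ i ≤ ρ k → (u : T (suc (ρ i))) → ∀ y z →
                 mapApp i u y ⊙⟨ k ⟩ z ≈ mul i u (y ⊙⟨ k ⟩ z) + mul k u (coM k y z)
    mapApp-rel {i} {k} i≤k u y z = additive-ext FAgroup
      (additive-∘ (⊙-additiveˡ k z) (lift-additive FAgroup _))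
      (additive-+ (additive-∘ (mul-additive i u) (⊙-additiveˡ k z))
                  (additive-∘ (mul-additive k u) (additive-sub (⊙-additiveˡ o z) (⊙-additiveˡ k z))))
      (λ t → reflexive (mul-ge {le = z≤n} i≤k z)) y

    -- The critical pair j ≤ i ≤ k: the left factor u ⊙ⱼ v is first rewritten against y, and each of
    -- the two summands is then multiplied by z. All hypotheses concern the smaller trees `u` and
    -- `v`.
    step : ∀ {b c} {i j k} (u : T b) (v : T c) → Rel j k u → Rel i k u → Rel i k v → Rel o k v → Rel o o v →
           ∀ y z → (mul j u (mul i v y) + mul i u (mul o v y - mul i v y)) ⊙⟨ k ⟩ z ≈
             (mul j u (mul i v (y ⊙⟨ k ⟩ z)) + mul i u (mul o v (y ⊙⟨ k ⟩ z) - mul i v (y ⊙⟨ k ⟩ z)))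
             + (mul j u (mul k v (coM k y z)) + mul k u (mul o v (coM k y z) - mul k v (coM k y z)))
    step {i = i} {j} {k} u v uj ui vi vo voo y z = begin
      mul j u A ⊙⟨ k ⟩ z + mul i u W ⊙⟨ k ⟩ z
        ≈⟨ +-cong (uj A z) (ui W z) ⟩
      (mul j u (A ⊙⟨ k ⟩ z) + mul k u (coM k A z)) + (mul i u (W ⊙⟨ k ⟩ z) + mul k u (coM k W z))
        ≈⟨ solve ((v0 ⊕ v1) ⊕ (v2 ⊕ v3)) (v0 ⊕ v2 ⊕ (v1 ⊕ v3)) ≡.refl (_ ∷ _ ∷ _ ∷ _ ∷ []) ⟩
      mul j u (A ⊙⟨ k ⟩ z) + mul i u (W ⊙⟨ k ⟩ z) + (mul k u (coM k A z) + mul k u (coM k W z))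
        ≈⟨ +-cong (+-cong (trans (J.f-cong e₁) (J.f-+ _ _)) (Iu.f-cong e₂))
                  (trans (sym (K.f-+ _ _)) (K.f-cong e₃)) ⟩
      (mul j u P + mul j u Q) + mul i u (mul o v Yk - P) + mul k u (mul o v D - Q)
        ≈⟨ solve ((v0 ⊕ v1) ⊕ v2 ⊕ v3) ((v0 ⊕ v2) ⊕ (v1 ⊕ v3)) ≡.refl (_ ∷ _ ∷ _ ∷ _ ∷ []) ⟩
      _ ∎
      where
      A  = mul i v y
      W  = mul o v y - mul i v y
      Yk = y ⊙⟨ k ⟩ z
      Yo = y ⊙⟨ o ⟩ z
      D  = coM k y z
      P  = mul i v Yk
      Q  = mul k v D
      module J = Additive (mul-additive j u)
      module Iu = Additive (mul-additive i u)
      module K = Additive (mul-additive k u)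
      e₁ : A ⊙⟨ k ⟩ z ≈ P + Q
      e₁ = vi y z
      e₂ : W ⊙⟨ k ⟩ z ≈ mul o v Yk - P
      e₂ = begin
        mul o v y ⊙⟨ k ⟩ z - A ⊙⟨ k ⟩ z   ≈⟨ sub-cong (vo y z) e₁ ⟩
        (mul o v Yk + Q) - (P + Q)         ≈⟨ solve ((v0 ⊕ v1) ⊝ (v2 ⊕ v1)) (v0 ⊝ v2) ≡.refl (_ ∷ _ ∷ _ ∷ []) ⟩
        mul o v Yk - P ∎
      -- `A` and `W` add up to v ⊙₀ y, so the left side is `coM k` of v ⊙₀ y; associativity of ⊙₀,
      -- the case `voo`, then brings v to the front.
      e₃ : coM k A z + coM k W z ≈ mul o v D - Q
      e₃ = begin
        (A ⊙⟨ o ⟩ z - A ⊙⟨ k ⟩ z) + ((mul o v y ⊙⟨ o ⟩ z - A ⊙⟨ o ⟩ z) - (mul o v y ⊙⟨ k ⟩ z - A ⊙⟨ k ⟩ z))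
          ≈⟨ solve ((v0 ⊝ v1) ⊕ ((v2 ⊝ v0) ⊝ (v3 ⊝ v1))) (v2 ⊝ v3) ≡.refl (_ ∷ _ ∷ _ ∷ _ ∷ []) ⟩
        mul o v y ⊙⟨ o ⟩ z - mul o v y ⊙⟨ k ⟩ z
          ≈⟨ sub-cong (trans (voo y z) (trans (+-cong refl (trans (O.f-cong (-‿inverseʳ Yo)) O.f-0)) (+-identityʳ _)))
                    (vo y z) ⟩
        mul o v Yo - (mul o v Yk + Q)
          ≈⟨ solve (v0 ⊝ (v1 ⊕ v2)) ((v0 ⊝ v1) ⊝ v2) ≡.refl (_ ∷ _ ∷ _ ∷ []) ⟩
        (mul o v Yo - mul o v Yk) - Q
          ≈⟨ sub-cong (sym (O.f-sub Yo Yk)) refl ⟩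
        mul o v D - Q ∎
        where module O = Additive (mul-additive o v)

  mul-rel : ∀ {b i k} → ρ i ≤ ρ k → (t : T b) → Rel i k t
  mul-rel i≤k (leaf x) y z = mapApp-rel i≤k (leaf x) y z
  mul-rel {i = i} {k} i≤k (app j le u v) y z with suc (ρ i) ≤? ρ j
  ... | yes lt = trans (mapApp-rel i≤k (app j lt u v) y z)
                   (+-cong (reflexive (mul-lt {le = lt} lt _)) (reflexive (mul-bound k lt le _)))
  ... | no ¬lt = trans
    (step u v (mul-rel (ℕₚ.≤-trans j≤i i≤k) u) (mul-rel i≤k u) (mul-rel i≤k v)
              (mul-rel (o-min k) v) (mul-rel ℕₚ.≤-refl v) y z)
    (+-cong refl (reflexive (≡.sym (mul-ge {le = le} (ℕₚ.≤-trans j≤i i≤k) _))))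
    where
    j≤i : ρ j ≤ ρ i
    j≤i = ℕₚ.≮⇒≥ ¬lt

  treeAlg : Alg 𝕀 a a
  treeAlg = record
    { group   = FAgroup
    ; op      = λ k m d → m ⊙⟨ k ⟩ d
    ; op-cong = λ k {x} {x′} {y} {y′} p q →
        trans (Additive.f-cong (⊙-additiveˡ k y) p) (Additive.f-cong (⊙-additiveʳ k x′) q)
    ; op-+ˡ   = λ _ _ _ _ → refl
    ; op-+ʳ   = λ k x y y′ → Additive.f-+ (⊙-additiveʳ k x) y y′
    ; rel     = λ {i} {k} i≤k x y z → additive-ext FAgroup
        (additive-∘ (⊙-additiveˡ k z) (⊙-additiveˡ i y))
        (additive-+ (⊙-additiveˡ i (y ⊙⟨ k ⟩ z)) (⊙-additiveˡ k (coM k y z)))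
        (λ t → mul-rel i≤k t y z) x }

  module _ {b ℓ} (B : Alg 𝕀 b ℓ) where
    private module B = Alg B

    record IsHom (h : FA → B.Carrier) : Set (a ⊔ b ⊔ ℓ) where
      field
        additive : Additive FAgroup B.group h
        hom      : ∀ k m d → h (m ⊙⟨ k ⟩ d) B.≈ B.op k (h m) (h d)
      open Additive additive public

  module _ {b ℓ} (B : Alg 𝕀 b ℓ) (f : X → Alg.Carrier B) where
    private module B = Alg B

    evT : ∀ {b} → T b → B.Carrier
    evT (leaf x)      = f x
    evT (app j _ u v) = B.op j (evT u) (evT v)

    ev : FA → B.Carrier
    ev = lift B.group evT

    private
      ev-mapApp : ∀ k (u : T (suc (ρ k))) d → ev (mapApp k u d) B.≈ B.op k (evT u) (ev d)
      ev-mapApp k u = additive-ext B.group (additive-∘ (lift-additive B.group evT) (lift-additive FAgroup _))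
        (additive-∘ (B.opʳ k _) (lift-additive B.group evT)) (λ _ → B.refl)

      evT-mul : ∀ {b} k (t : T b) d → ev (mul k t d) B.≈ B.op k (evT t) (ev d)
      evT-mul k (leaf x) d = ev-mapApp k (leaf x) d
      evT-mul k (app j _ u v) d with suc (ρ k) ≤? ρ j
      ... | yes lt = ev-mapApp k (app j lt u v) d
      ... | no ¬lt = B.trans
        (B.+-cong (B.trans (evT-mul j u _) (B.op-cong j B.refl (evT-mul k v d)))
                  (B.trans (evT-mul k u _) (B.op-cong k B.refl (B.sub-cong (evT-mul o v d) (evT-mul k v d)))))
        (B.sym (B.rel (ℕₚ.≮⇒≥ ¬lt) _ _ _))

    ev-isHom : IsHom B ev
    ev-isHom = record
      { additive = lift-additive B.group evT
      ; hom = λ k m d → additive-ext B.group (additive-∘ (lift-additive B.group evT) (⊙-additiveˡ k d))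
                (additive-∘ (B.opˡ k (ev d)) (lift-additive B.group evT)) (λ t → evT-mul k t d) m }

  -- No rewriting takes place, because the left spine of `u` has only ranks above that of j.
  -- Inductions over trees can thus treat every node as a product.
  gen-app : ∀ j (u : T (suc (ρ j))) v → gen (wk u) ⊙⟨ j ⟩ gen v ≡ gen (app j z≤n u v)
  gen-app j (leaf x) v         = ≡.refl
  gen-app j (app i lt u w) v   = mul-lt {le = z≤n} lt (gen v)

  hom-ext : ∀ {b ℓ} (B : Alg 𝕀 b ℓ) {g h} → IsHom B g → IsHom B h →
            (∀ x → Alg._≈_ B (g (gen (leaf x))) (h (gen (leaf x)))) → ∀ m → Alg._≈_ B (g m) (h m)
  hom-ext B {g} {h} G H e = additive-ext B.group (IsHom.additive G) (IsHom.additive H)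
    (λ t → ≡.subst (λ t → g (gen t) B.≈ h (gen t)) (wk-id t) (tree t))
    where
    module B = Alg B
    tree : ∀ {b} (t : T b) → g (gen (wk t)) B.≈ h (gen (wk t))
    tree (leaf x)      = e x
    tree (app j _ u v) = ≡.subst (λ m → g m B.≈ h m) (gen-app j u v)
      (B.trans (IsHom.hom G j _ _)
        (B.trans (B.op-cong j (tree u) (≡.subst (λ t → g (gen t) B.≈ h (gen t)) (wk-id v) (tree v)))
          (B.sym (IsHom.hom H j _ _))))

-- Forgetting one operation

-- Positivity of `q` keeps the operation `o`, which enters every relation through `co`; the
-- surviving relations are then among the old ones.
remove : (𝕀 : Index) (q : ℕ) → 0 < q → Index
remove 𝕀 q 0<q = record
  { I = Σ I (λ i → ρ i ≢ q) ; ρ = λ i → ρ (proj₁ i)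
  ; o = o , (λ e → ℕₚ.<⇒≢ 0<q (≡.trans (≡.sym ρo) e)) ; ρo = ρo }
  where open Index 𝕀

restrict : ∀ {𝕀 q} (0<q : 0 < q) {b ℓ} → Alg 𝕀 b ℓ → Alg (remove 𝕀 q 0<q) b ℓ
restrict 0<q B = record
  { group = group ; op = λ i → op (proj₁ i)
  ; op-cong = λ i → op-cong (proj₁ i) ; op-+ˡ = λ i → op-+ˡ (proj₁ i) ; op-+ʳ = λ i → op-+ʳ (proj₁ i)
  ; rel = rel }
  where open Alg B

-- Right modules over an algebra, and their twists

module Act {𝕁 : Index} {b ℓ} (B : Alg 𝕁 b ℓ) where
  open Index 𝕁 renaming (I to J; ρ to ρJ; o to oJ; o-min to oJ-min)
  private module B = Alg B

  -- In the relation for (x ⊙ᵢ c) ⊙ₖ d only x stands leftmost throughout, so x may come from a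
  -- different group. Such a group will hold the values of products whose left part uses the
  -- forgotten operation.
  record RMod n ℓn : Set (b ⊔ ℓ ⊔ lsuc (n ⊔ ℓn)) where
    no-eta-equality
    field
      group : AbelianGroup n ℓn
    open Ab group public
    field
      act      : J → Carrier → B.Carrier → Carrier
      act-cong : ∀ i {x x′ c c′} → x ≈ x′ → c B.≈ c′ → act i x c ≈ act i x′ c′
      act-+ˡ   : ∀ i x x′ c → act i (x + x′) c ≈ act i x c + act i x′ c
      act-+ʳ   : ∀ i x c c′ → act i x (c B.+ c′) ≈ act i x c + act i x c′
      act-rel  : ∀ {i k} → ρJ i ≤ ρJ k → ∀ x c d →
                 act k (act i x c) d ≈ act i x (B.op k c d) + act k x (B.co k c d)

    actˡ : ∀ i c → Additive group group (λ x → act i x c)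
    actˡ i c = record { f-cong = λ p → act-cong i p B.refl ; f-+ = λ x x′ → act-+ˡ i x x′ c }

    actʳ : ∀ i x → Additive B.group group (act i x)
    actʳ i x = record { f-cong = act-cong i refl ; f-+ = act-+ʳ i x }

  regular : RMod b ℓ
  regular = record
    { group = B.group ; act = B.op ; act-cong = B.op-cong ; act-+ˡ = B.op-+ˡ ; act-+ʳ = B.op-+ʳ ; act-rel = B.rel }

  -- The correction term of `rel` depends on k, x, y, z but not on i, hence cancels between ⊙₀ and
  -- ⊙ᵢ.
  co-op : ∀ {i k} → ρJ i ≤ ρJ k → ∀ x y z → B.op k (B.co i x y) z B.≈ B.co i x (B.op k y z)
  co-op {i} {k} i≤k x y z = begin
    op k (co i x y) z                                     ≈⟨ Additive.f-sub (opˡ k z) _ _ ⟩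
    op k (op oJ x y) z - op k (op i x y) z                 ≈⟨ sub-cong (rel (oJ-min k) x y z) (rel i≤k x y z) ⟩
    (op oJ x (op k y z) + op k x (co k y z)) - (op i x (op k y z) + op k x (co k y z))
      ≈⟨ solve ((v0 ⊕ v1) ⊝ (v2 ⊕ v1)) (v0 ⊝ v2) ≡.refl (_ ∷ _ ∷ _ ∷ []) ⟩
    co i x (op k y z) ∎
    where open Alg B

  op-assoc : ∀ x y z → B.op oJ (B.op oJ x y) z B.≈ B.op oJ x (B.op oJ y z)
  op-assoc x y z = begin
    op oJ (op oJ x y) z                     ≈⟨ rel ℕₚ.≤-refl x y z ⟩
    op oJ x (op oJ y z) + op oJ x (co oJ y z) ≈⟨ +-cong refl (Additive.f-cong (opʳ oJ x) (-‿inverseʳ _)) ⟩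
    op oJ x (op oJ y z) + op oJ x 0#         ≈⟨ +-cong refl (Additive.f-0 (opʳ oJ x)) ⟩
    op oJ x (op oJ y z) + 0#                ≈⟨ +-identityʳ _ ⟩
    op oJ x (op oJ y z) ∎
    where open Alg B

  -- Associativity of ⊙₀ minus the relation between ⊙₀ and ⊙ₖ.
  co-assoc : ∀ k x y z → B.co k (B.op oJ x y) z B.≈ B.co k x (B.co k y z)
  co-assoc k x y z = begin
    op oJ (op oJ x y) z - op k (op oJ x y) z  ≈⟨ sub-cong (op-assoc x y z) (rel (oJ-min k) x y z) ⟩
    op oJ x (op oJ y z) - (op oJ x (op k y z) + op k x (co k y z))
      ≈⟨ solve (v0 ⊝ (v1 ⊕ v2)) ((v0 ⊝ v1) ⊝ v2) ≡.refl (_ ∷ _ ∷ _ ∷ []) ⟩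
    (op oJ x (op oJ y z) - op oJ x (op k y z)) - op k x (co k y z)
      ≈⟨ sub-cong (sym (Additive.f-sub (opʳ oJ x) _ _)) refl ⟩
    co k x (co k y z) ∎
    where open Alg B

  module Twist {n ℓn} (N : RMod n ℓn) (n₀ : RMod.Carrier N) where
    private module N = RMod N

    -- If n₀ is the value of u, then (n , c) holds the values of u ⊙ⱼ w and of w for some j ≤ k;
    -- the first entry is the value of u ⊙ⱼ (w ⊙ₖ z) = (u ⊙ⱼ w) ⊙ₖ z − u ⊙ₖ (w ⊙₀ z − w ⊙ₖ z).
    tact : J → N.Carrier × B.Carrier → B.Carrier → N.Carrier × B.Carrier
    tact k (n , c) d = N.act k n d N.- N.act k n₀ (B.co k c d) , B.op k c d

    tgroup : AbelianGroup (n ⊔ b) (ℓn ⊔ ℓ)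
    tgroup = DP.abelianGroup N.group B.group

    open AbelianGroup tgroup using () renaming (Carrier to C; _≈_ to _≈ₜ_; _∙_ to _+ₜ_)

    abstract
      tact-cong : ∀ k {x x′ c c′} → x ≈ₜ x′ → c B.≈ c′ → tact k x c ≈ₜ tact k x′ c′
      tact-cong k (p , q) r =
        N.sub-cong (N.act-cong k p r) (N.act-cong k N.refl (B.co-cong k q r)) , B.op-cong k q r

      tact-+ˡ : ∀ k x x′ c → tact k (x +ₜ x′) c ≈ₜ (tact k x c +ₜ tact k x′ c)
      tact-+ˡ k (n , c) (n′ , c′) d =
        N.trans (N.sub-cong (N.act-+ˡ k n n′ d)
                  (N.trans (N.act-cong k N.refl (Additive.f-+ (B.coˡ k d) c c′)) (N.act-+ʳ k n₀ _ _)))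
                (N.solve ((v0 ⊕ v1) ⊝ (v2 ⊕ v3)) ((v0 ⊝ v2) ⊕ (v1 ⊝ v3)) ≡.refl (_ ∷ _ ∷ _ ∷ _ ∷ []))
        , B.op-+ˡ k c c′ d

      tact-+ʳ : ∀ k x c c′ → tact k x (c B.+ c′) ≈ₜ (tact k x c +ₜ tact k x c′)
      tact-+ʳ k (n , c) d d′ =
        N.trans (N.sub-cong (N.act-+ʳ k n d d′)
                  (N.trans (N.act-cong k N.refl (Additive.f-+ (B.coʳ k c) d d′)) (N.act-+ʳ k n₀ _ _)))
                (N.solve ((v0 ⊕ v1) ⊝ (v2 ⊕ v3)) ((v0 ⊝ v2) ⊕ (v1 ⊝ v3)) ≡.refl (_ ∷ _ ∷ _ ∷ _ ∷ []))
        , B.op-+ʳ k c d d′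

      tact-rel : ∀ {i k} → ρJ i ≤ ρJ k → ∀ x c d →
                 tact k (tact i x c) d ≈ₜ (tact i x (B.op k c d) +ₜ tact k x (B.co k c d))
      tact-rel {i} {k} i≤k (n , c) y z = first , B.rel i≤k c y z
        where
        open Ab N.group
        P Q : Carrier
        P = N.act i n (B.op k y z)
        Q = N.act k n (B.co k y z)
        -- The inner products add up to c ⊙₀ y, to which `co-assoc` applies.
        co-sum : B.co k (B.co i c y) z B.+ B.co k (B.op i c y) z B.≈ B.co k c (B.co k y z)
        co-sum = B.trans (B.sym (Additive.f-+ (B.coˡ k z) _ _))
                   (B.trans (B.co-cong k (B.x-y+y≈x _ _) B.refl) (co-assoc k c y z))
        first : N.act k (N.act i n y - N.act i n₀ (B.co i c y)) z - N.act k n₀ (B.co k (B.op i c y) z) ≈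
                (P - N.act i n₀ (B.co i c (B.op k y z))) + (Q - N.act k n₀ (B.co k c (B.co k y z)))
        first = begin
          N.act k (N.act i n y - N.act i n₀ (B.co i c y)) z - N.act k n₀ (B.co k (B.op i c y) z)
            ≈⟨ sub-cong (trans (Additive.f-sub (N.actˡ k z) _ _)
                           (sub-cong (N.act-rel i≤k n y z) (N.act-rel i≤k n₀ (B.co i c y) z))) refl ⟩
          ((P + Q) - (N.act i n₀ (B.op k (B.co i c y) z) + N.act k n₀ (B.co k (B.co i c y) z)))
            - N.act k n₀ (B.co k (B.op i c y) z)
            ≈⟨ solve (((v0 ⊕ v1) ⊝ (v2 ⊕ v3)) ⊝ v4) ((v0 ⊝ v2) ⊕ (v1 ⊝ (v3 ⊕ v4))) ≡.refl (_ ∷ _ ∷ _ ∷ _ ∷ _ ∷ []) ⟩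
          (P - N.act i n₀ (B.op k (B.co i c y) z))
            + (Q - (N.act k n₀ (B.co k (B.co i c y) z) + N.act k n₀ (B.co k (B.op i c y) z)))
            ≈⟨ +-cong (sub-cong refl (N.act-cong i refl (co-op i≤k c y z)))
                      (sub-cong refl (trans (sym (N.act-+ʳ k n₀ _ _)) (N.act-cong k refl co-sum))) ⟩
          (P - N.act i n₀ (B.co i c (B.op k y z))) + (Q - N.act k n₀ (B.co k c (B.co k y z))) ∎

    twist : RMod (n ⊔ b) (ℓn ⊔ ℓ)
    twist = record
      { group = tgroup ; act = tact ; act-cong = tact-cong
      ; act-+ˡ = tact-+ˡ ; act-+ʳ = tact-+ʳ ; act-rel = tact-rel }

  open Twist public using (twist)

-- The generators that appear when the operations of rank q are forgotten

module Merge (𝕀 : Index) (q : ℕ) (0<q : 0 < q) {a} (X : Set a) where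
  open Index 𝕀
  𝕁 : Index
  𝕁 = remove 𝕀 q 0<q
  open Index 𝕁 using () renaming (I to J)
  open Trees 𝕀 X

  -- Only ranks ≤ q occur along the right spine: a right factor v ⊙ₖ w with k > q can be moved out,
  -- since u ⊙ⱼ (v ⊙ₖ w) = (u ⊙ⱼ v) ⊙ₖ w - u ⊙ₖ (v ⊙₀ w - v ⊙ₖ w) for j ≤ k.
  data H : Set a where
    leaf : X → H
    app  : (j : I) → ρ j ≤ q → T (suc (ρ j)) → H → H

  data Y : Set a where
    base : X → Y
    ext  : (j : I) → ρ j ≡ q → T (suc (ρ j)) → H → Y

  κH : H → T 0
  κH (leaf x)      = leaf x
  κH (app j _ u h) = app j z≤n u (κH h)

  κ : Y → T 0
  κ (base x)      = leaf x
  κ (ext j _ u h) = app j z≤n u (κH h)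

  module Extend {b ℓ} (B : Alg 𝕁 b ℓ) (f₀ : Y → Alg.Carrier B) where
    private
      module B = Alg B
      module M = Ab FAgroup
    open Act B

    Mod : Set (lsuc (b ⊔ ℓ))
    Mod = RMod b ℓ

    -- The value at κH (app j u h), when u has value β and κH h has value c.
    extVal : (j : I) → T (suc (ρ j)) → B.Carrier → H → B.Carrier → B.Carrier
    extVal j u β h c with ℕₚ.<-cmp (ρ j) q
    ... | tri< _ ¬e _ = B.op (j , ¬e) β c
    ... | tri≈ _ e _  = f₀ (ext j e u h)
    -- An arbitrary value: combs contain only ranks at most q.
    ... | tri> _ _ _  = B.0#

    inner : ∀ {n} {N : Set n} → (H → B.Carrier → N) → (j : I) → ρ j ≤ q → T (suc (ρ j)) → B.Carrier →
            H → B.Carrier → N × B.Carrier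
    inner f j j≤q u β h c = f (app j j≤q u h) (extVal j u β h c) , c

    -- This is the map that sends `κH h` to `f h (val h)` and turns right multiplication by ⊙ₖ, k >
    -- q, into the action of `N`; see `loop-κH`, `loop-hom` and `loop-unique`. For j ≤ q the map w ↦
    -- u ⊙ⱼ w does not respect ⊙ₖ, but paired with w it does, as a map into the twisted module. So
    -- the recursion descends into `v` with a larger module, and `inner` prolongs the comb by one
    -- node.
    loop : ∀ {b} (N : Mod) → (H → B.Carrier → RMod.Carrier N) → T b → RMod.Carrier N
    gT : ∀ {b} → T b → B.Carrier

    loop N f (leaf x) = f (leaf x) (f₀ (base x))
    loop N f (app j _ u v) with ℕₚ.<-≤-connex q (ρ j)
    ... | inj₁ gt  = RMod.act N (j , ℕₚ.>⇒≢ gt) (loop N f u) (gT v)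
    ... | inj₂ j≤q = proj₁ (loop (twist N (loop N f u)) (inner f j j≤q u (gT u)) v)

    gT t = loop regular (λ _ c → c) t

    extVal-< : ∀ j u β h c → ρ j < q → (¬e : ρ j ≢ q) → extVal j u β h c ≡ B.op (j , ¬e) β c
    extVal-< j u β h c lt ¬e with ℕₚ.<-cmp (ρ j) q
    ... | tri< _ _ _   = ≡.refl
    ... | tri≈ ¬lt _ _ = ⊥-elim (¬lt lt)
    ... | tri> ¬lt _ _ = ⊥-elim (¬lt lt)

    extVal-≡ : ∀ j u β h c → (e : ρ j ≡ q) → extVal j u β h c ≡ f₀ (ext j e u h)
    extVal-≡ j u β h c e with ℕₚ.<-cmp (ρ j) q
    ... | tri< _ ¬e _ = ⊥-elim (¬e e)
    ... | tri≈ _ e′ _ = ≡.cong (λ p → f₀ (ext j p u h)) (ℕₚ.≡-irrelevant _ _)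
    ... | tri> _ ¬e _ = ⊥-elim (¬e e)

    loop-high : ∀ {b} (N : Mod) f j {le : b ≤ ρ j} u v → q < ρ j → (¬e : ρ j ≢ q) →
                loop N f (app j le u v) ≡ RMod.act N (j , ¬e) (loop N f u) (gT v)
    loop-high N f j u v gt ¬e with ℕₚ.<-≤-connex q (ρ j)
    ... | inj₁ _   = ≡.refl
    ... | inj₂ j≤q = ⊥-elim (ℕₚ.<⇒≱ gt j≤q)

    loop-low : ∀ {b} (N : Mod) f j {le : b ≤ ρ j} u v → (j≤q : ρ j ≤ q) →
               loop N f (app j le u v) ≡ proj₁ (loop (twist N (loop N f u)) (inner f j j≤q u (gT u)) v)
    loop-low N f j u v j≤q with ℕₚ.<-≤-connex q (ρ j)
    ... | inj₁ gt = ⊥-elim (ℕₚ.<⇒≱ gt j≤q)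
    ... | inj₂ p with ≡.refl ← ℕₚ.≤-irrelevant p j≤q = ≡.refl

    loop-bound : ∀ {b c} (N : Mod) f j {le : b ≤ ρ j} {le′ : c ≤ ρ j} u v →
                 loop N f (app j le u v) ≡ loop N f (app j le′ u v)
    loop-bound N f j u v with ℕₚ.<-≤-connex q (ρ j)
    ... | inj₁ _ = ≡.refl
    ... | inj₂ _ = ≡.refl

    record IsModMap (N P : Mod) (ψ : RMod.Carrier N → RMod.Carrier P) : Set (b ⊔ ℓ) where
      private
        module N = RMod N
        module P = RMod P
      field
        additive : Additive N.group P.group ψ
        act-hom  : ∀ k → q < ρ (proj₁ k) → ∀ n c → ψ (N.act k n c) P.≈ P.act k (ψ n) c
      open Additive additive public

    -- Compatibility with the actions of rank above q suffices, because `loop` calls no others.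
    -- Twisting both modules replaces ψ by its product with the identity of `B`.
    loop-natural : ∀ {b} (N P : Mod) {ψ} {fN fP} → IsModMap N P ψ → (∀ h c → RMod._≈_ P (ψ (fN h c)) (fP h c)) →
                   ∀ (t : T b) → RMod._≈_ P (ψ (loop N fN t)) (loop P fP t)
    loop-natural N P {ψ} {fN} {fP} Ψ e (leaf x) = e _ _
    loop-natural N P {ψ} {fN} {fP} Ψ e (app j le u v) = go (ℕₚ.<-≤-connex q (ρ j))
      where
      module P = RMod P
      module N = RMod N
      IHu : ψ (loop N fN u) P.≈ loop P fP u
      IHu = loop-natural N P Ψ e u
      Ψ′ : IsModMap (twist N (loop N fN u)) (twist P (loop P fP u)) (λ (n , c) → ψ n , c)
      Ψ′ = record
        { additive = record
          { f-cong = λ (p , r) → IsModMap.f-cong Ψ p , r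
          ; f-+ = λ x y → IsModMap.f-+ Ψ _ _ , B.refl }
        ; act-hom = λ k hi (n , c) d →
            P.trans (IsModMap.f-sub Ψ _ _)
              (P.sub-cong (IsModMap.act-hom Ψ k hi n d)
                (P.trans (IsModMap.act-hom Ψ k hi _ _) (P.act-cong k IHu B.refl))) , B.refl }
      go : q < ρ j ⊎ ρ j ≤ q → ψ (loop N fN (app j le u v)) P.≈ loop P fP (app j le u v)
      go (inj₁ hi) = P.trans (IsModMap.f-cong Ψ (N.reflexive (loop-high N fN j {le} u v hi (ℕₚ.>⇒≢ hi))))
        (P.trans (IsModMap.act-hom Ψ _ hi _ _) (P.trans (P.act-cong _ IHu B.refl)
          (P.reflexive (≡.sym (loop-high P fP j {le} u v hi (ℕₚ.>⇒≢ hi))))))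
      go (inj₂ j≤q) = P.trans (IsModMap.f-cong Ψ (N.reflexive (loop-low N fN j {le} u v j≤q)))
        (P.trans (proj₁ (loop-natural (twist N (loop N fN u)) (twist P (loop P fP u)) {fN = inner fN j j≤q u (gT u)}
                           {fP = inner fP j j≤q u (gT u)} Ψ′ (λ h c → e _ _ , B.refl) v))
          (P.reflexive (≡.sym (loop-low P fP j {le} u v j≤q))))

    -- As ⊙ⱼ still exists in `B`, the map c ↦ (gT u ⊙ⱼ c , c) is a module map from `regular` to its
    -- twist, and by naturality the detour through combs returns the plain product.
    gT-low : ∀ {b} j {le : b ≤ ρ j} u v → ρ j < q → (¬e : ρ j ≢ q) →
             gT (app j le u v) B.≈ B.op (j , ¬e) (gT u) (gT v)
    gT-low j {le} u v lt ¬e = B.trans (B.reflexive (loop-low regular (λ _ c → c) j {le} u v (ℕₚ.<⇒≤ lt)))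
      (B.sym (proj₁ (loop-natural regular (twist regular (gT u)) Ψ
        (λ h c → B.reflexive (≡.sym (extVal-< j u (gT u) h c lt ¬e)) , B.refl) v)))
      where
      Ψ : IsModMap regular (twist regular (gT u)) (λ c → B.op (j , ¬e) (gT u) c , c)
      Ψ = record
        { additive = record
          { f-cong = λ p → B.op-cong _ B.refl p , p
          ; f-+ = λ x y → B.op-+ʳ _ _ _ _ , B.refl }
        ; act-hom = λ k hi n c →
            B.trans (B.solve v0 ((v0 ⊕ v1) ⊝ v1) ≡.refl (_ ∷ B.op k (gT u) (B.co k n c) ∷ []))
              (B.sub-cong (B.sym (B.rel (ℕₚ.<⇒≤ (ℕₚ.<-trans lt hi)) (gT u) n c)) B.refl) , B.refl }

    loop-proj₂ : ∀ {b} (N : Mod) {n₀ f′} → (∀ h c → proj₂ (f′ h c) ≡ c) → ∀ (t : T b) →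
                 proj₂ (loop (twist N n₀) f′ t) B.≈ gT t
    loop-proj₂ N {n₀} e t = loop-natural (twist N n₀) regular Ψ (λ h c → B.reflexive (e h c)) t
      where
      Ψ : IsModMap (twist N n₀) regular proj₂
      Ψ = record
        { additive = record { f-cong = proj₂ ; f-+ = λ _ _ → B.refl }
        ; act-hom = λ _ _ _ _ → B.refl }

    L : (N : Mod) → (H → B.Carrier → RMod.Carrier N) → FA → RMod.Carrier N
    L N f = lift (RMod.group N) (loop N f)

    L-additive : ∀ (N : Mod) f → Additive FAgroup (RMod.group N) (L N f)
    L-additive N f = lift-additive (RMod.group N) _

    g : FA → B.Carrier
    g = lift B.group gT

    g-additive : Additive FAgroup B.group g
    g-additive = lift-additive B.group _

    private
      L-mapApp : ∀ (N : Mod) f k (hi : q < ρ (proj₁ k)) u z →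
                 RMod._≈_ N (L N f (mapApp (proj₁ k) u z)) (RMod.act N k (loop N f u) (g z))
      L-mapApp N f k hi u = additive-ext (RMod.group N)
        (additive-∘ (L-additive N f) (lift-additive FAgroup _))
        (additive-∘ (RMod.actʳ N k _) g-additive)
        (λ v → RMod.reflexive N (loop-high N f (proj₁ k) {z≤n} u v hi (proj₂ k)))

      g-mapApp : ∀ k (lo : ρ (proj₁ k) < q) u z →
                 g (mapApp (proj₁ k) u z) B.≈ B.op k (gT u) (g z)
      g-mapApp k lo u = additive-ext B.group
        (additive-∘ g-additive (lift-additive FAgroup _))
        (additive-∘ (B.opʳ k _) g-additive)
        (λ v → gT-low (proj₁ k) {z≤n} u v lo (proj₂ k))

      oJ : J
      oJ = Index.o 𝕁

    -- Mutual recursion on the tree with `gT-hom`. At a node of rank ≤ q, the correction subtracted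
    -- by the twisted action is exactly the second summand that `mul` adds.
    loop-hom : ∀ {b} (N : Mod) f (t : T b) k → q < ρ (proj₁ k) → ∀ z →
               RMod._≈_ N (L N f (mul (proj₁ k) t z)) (RMod.act N k (loop N f t) (g z))
    -- Above q this is `loop-hom` for the regular module. For k below q, a node that has to be
    -- rewritten has rank j ≤ k < q, so only operations present in `B` occur.
    gT-hom : ∀ {b} (t : T b) k z → g (mul (proj₁ k) t z) B.≈ B.op k (gT t) (g z)

    loop-hom N f (leaf x) k hi z = L-mapApp N f k hi (leaf x) z
    loop-hom N f (app j le u v) k hi z with suc (ρ (proj₁ k)) ≤? ρ j
    ... | yes lt = N.trans (L-mapApp N f k hi (app j lt u v) z)
                     (N.act-cong k (N.reflexive (loop-bound N f j {lt} {le} u v)) B.refl)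
      where module N = RMod N
    ... | no ¬lt = go (ℕₚ.<-≤-connex q (ρ j))
      where
      module N = RMod N
      k₀ = proj₁ k
      second : L N f (mul k₀ u (mul o v z M.- mul k₀ v z)) N.≈ N.act k (loop N f u) (B.co k (gT v) (g z))
      second = N.trans (loop-hom N f u k hi _)
        (N.act-cong k N.refl (B.sub-cong (gT-hom v oJ z) (gT-hom v k z)))
      go : q < ρ j ⊎ ρ j ≤ q →
           L N f (mul j u (mul k₀ v z)) N.+ L N f (mul k₀ u (mul o v z M.- mul k₀ v z)) N.≈
           N.act k (loop N f (app j le u v)) (g z)
      go (inj₁ gt) = N.trans
        (N.+-cong (N.trans (loop-hom N f u j′ gt _) (N.act-cong j′ N.refl (gT-hom v k z))) second)
        (N.trans (N.sym (N.act-rel (ℕₚ.≮⇒≥ ¬lt) _ _ _))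
          (N.act-cong k (N.sym (N.reflexive (loop-high N f j {le} u v gt (proj₂ j′)))) B.refl))
        where
        j′ : J
        j′ = j , ℕₚ.>⇒≢ gt
      go (inj₂ j≤q) = N.trans (N.+-cong first second) (N.x-y+y≈x _ _)
        where
        N′ = twist N (loop N f u)
        f′ = inner f j j≤q u (gT u)
        eq : ∀ {c} (le : c ≤ ρ j) v → loop N f (app j le u v) ≡ proj₁ (loop N′ f′ v)
        eq le v = loop-low N f j {le} u v j≤q
        unfold : ∀ w → L N f (mul j u w) N.≈ proj₁ (L N′ f′ w)
        unfold w = N.trans (N.reflexive (≡.cong (L N f) (mul-nf u w)))
          (additive-ext N.group (additive-∘ (L-additive N f) (lift-additive FAgroup _))
            (record { f-cong = λ p → proj₁ (Additive.f-cong (L-additive N′ f′) p)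
                    ; f-+ = λ x y → proj₁ (Additive.f-+ (L-additive N′ f′) x y) })
            (λ v → N.reflexive (eq z≤n v)) w)
        first : L N f (mul j u (mul k₀ v z)) N.≈
                N.act k (loop N f (app j le u v)) (g z) N.- N.act k (loop N f u) (B.co k (gT v) (g z))
        first = N.trans (unfold _) (N.trans (proj₁ (loop-hom N′ f′ v k hi z))
          (N.sub-cong (N.act-cong k (N.sym (N.reflexive (eq le v))) B.refl)
                      (N.act-cong k N.refl (B.co-cong k (loop-proj₂ N {loop N f u} {f′} (λ _ _ → ≡.refl) v) B.refl))))

    gT-hom t k z with ℕₚ.<-cmp (ρ (proj₁ k)) q
    gT-hom t k z | tri> _ _ hi = loop-hom regular (λ _ c → c) t k hi z
    gT-hom t k z | tri≈ _ e _  = ⊥-elim (proj₂ k e)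
    gT-hom (leaf x) k z | tri< lo _ _ = g-mapApp k lo (leaf x) z
    gT-hom (app j le u v) k z | tri< lo _ _ with suc (ρ (proj₁ k)) ≤? ρ j
    ... | yes lt = B.trans (g-mapApp k lo (app j lt u v) z)
                     (B.op-cong k (B.reflexive (loop-bound regular (λ _ c → c) j {lt} {le} u v)) B.refl)
    ... | no ¬lt = B.trans
        (B.+-cong (B.trans (gT-hom u j′ _) (B.op-cong j′ B.refl (gT-hom v k z)))
                  (B.trans (gT-hom u k _) (B.op-cong k B.refl (B.sub-cong (gT-hom v oJ z) (gT-hom v k z)))))
        (B.trans (B.sym (B.rel (ℕₚ.≮⇒≥ ¬lt) _ _ _))
          (B.op-cong k (B.sym (gT-low j {le} u v j<q (proj₂ j′))) B.refl))
      where
      j<q : ρ j < q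
      j<q = ℕₚ.≤-<-trans (ℕₚ.≮⇒≥ ¬lt) lo
      j′ : J
      j′ = j , ℕₚ.<⇒≢ j<q

    record IsRestrictedHom (h : FA → B.Carrier) : Set (a ⊔ b ⊔ ℓ) where
      field
        additive : Additive FAgroup B.group h
        hom      : ∀ k m d → h (m ⊙⟨ proj₁ k ⟩ d) B.≈ B.op k (h m) (h d)
      open Additive additive public

    g-isHom : IsRestrictedHom g
    g-isHom = record
      { additive = g-additive
      ; hom = λ k m d → additive-ext B.group (additive-∘ g-additive (⊙-additiveˡ (proj₁ k) d))
                (additive-∘ (B.opˡ k (g d)) g-additive) (λ t → gT-hom t k d) m }

    val : H → B.Carrier
    val (leaf x)      = f₀ (base x)
    val (app j _ u h) = extVal j u (gT u) h (val h)

    loop-κH : ∀ (N : Mod) f h → loop N f (κH h) ≡ f h (val h)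
    loop-κH N f (leaf x)       = ≡.refl
    loop-κH N f (app j le u h) = ≡.trans (loop-low N f j {z≤n} u (κH h) le)
      (≡.cong proj₁ (loop-κH (twist N (loop N f u)) (inner f j le u (gT u)) h))

    g-κ : ∀ y → g (gen (κ y)) ≡ f₀ y
    g-κ (base x)      = ≡.refl
    g-κ (ext j e u h) = ≡.trans (loop-κH regular (λ _ c → c) (app j (ℕₚ.≤-reflexive e) u h))
      (extVal-≡ j u (gT u) h (val h) e)

    module _ {h : FA → B.Carrier} (Hh : IsRestrictedHom h) (h-κ : ∀ y → h (gen (κ y)) B.≈ f₀ y) where
      private
        module h = IsRestrictedHom Hh
        module A = Alg treeAlg

      -- Below a node of rank ≤ q, ψ is replaced by m ↦ (ψ (u ⊙ⱼ m) , h m), which respects the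
      -- twisted action. Values on combs are forced: at rank < q because `h` is a homomorphism, at
      -- rank q by `h-κ`. Letting c be any element equal to `h (gen (κH p))` makes the hypothesis on
      -- combs pass to the twist.
      loop-unique : ∀ {b} (N : Mod) {ψ : FA → RMod.Carrier N} {f} → Additive FAgroup (RMod.group N) ψ →
        (∀ k → q < ρ (proj₁ k) → ∀ m z →
           RMod._≈_ N (ψ (m ⊙⟨ proj₁ k ⟩ z)) (RMod.act N k (ψ m) (h z))) →
        (∀ p c → c B.≈ h (gen (κH p)) → RMod._≈_ N (ψ (gen (κH p))) (f p c)) →
        (t : T b) → RMod._≈_ N (ψ (gen (wk t))) (loop N f t)
      gT-unique : ∀ {b} (t : T b) → h (gen (wk t)) B.≈ gT t

      gT-unique t = loop-unique regular h.additive (λ k _ → h.hom k) (λ _ _ → B.sym) t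

      loop-unique N Ψ act-hom e (leaf x) = e (leaf x) _ (B.sym (h-κ (base x)))
      loop-unique N {ψ} {f} Ψ act-hom e (app j le u v) = N.trans (N.reflexive (≡.cong ψ (≡.sym (gen-app j u v)))) (go (ℕₚ.<-≤-connex q (ρ j)))
        where
        module N = RMod N
        module Ψ = Additive Ψ
        IHu : ψ (gen (wk u)) N.≈ loop N f u
        IHu = loop-unique N Ψ act-hom e u
        hv : h (gen v) B.≈ gT v
        hv = B.trans (B.reflexive (≡.cong (λ t → h (gen t)) (≡.sym (wk-id v)))) (gT-unique v)
        N′ = twist N (loop N f u)
        ψ′ : FA → RMod.Carrier N′
        ψ′ m = ψ (gen (wk u) ⊙⟨ j ⟩ m) , h m
        Ψ′ : Additive FAgroup (RMod.group N′) ψ′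
        Ψ′ = record
          { f-cong = λ p → Additive.f-cong (additive-∘ Ψ (⊙-additiveʳ j (gen (wk u)))) p , h.f-cong p
          ; f-+ = λ x y → Additive.f-+ (additive-∘ Ψ (⊙-additiveʳ j (gen (wk u)))) x y , h.f-+ x y }
        h-co : ∀ k m z → h (A.co (proj₁ k) m z) B.≈ B.co k (h m) (h z)
        h-co k m z = B.trans (h.f-sub _ _) (B.sub-cong (h.hom oJ m z) (h.hom k m z))
        act-hom′ : ρ j ≤ q → ∀ k → q < ρ (proj₁ k) → ∀ m z →
                   RMod._≈_ N′ (ψ′ (m ⊙⟨ proj₁ k ⟩ z)) (RMod.act N′ k (ψ′ m) (h z))
        act-hom′ j≤q k hi m z = N.trans
          (N.trans (Ψ.f-cong (M.trans (M.solve v0 ((v0 ⊕ v1) ⊝ v1) ≡.refl (_ ∷ _ ∷ []))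
                     (M.sub-cong (M.sym (A.rel (ℕₚ.<⇒≤ (ℕₚ.≤-<-trans j≤q hi)) (gen (wk u)) m z)) M.refl)))
                   (Ψ.f-sub _ _))
          (N.sub-cong (act-hom k hi _ _)
             (N.trans (act-hom k hi _ _) (N.act-cong k IHu (h-co k m z)))) , h.hom k m z
        extVal-κ : ∀ p c (j≤q : ρ j ≤ q) → c B.≈ h (gen (κH p)) →
                   extVal j u (gT u) p c B.≈ h (gen (κH (app j j≤q u p)))
        extVal-κ p c j≤q eq with ℕₚ.m≤n⇒m<n∨m≡n j≤q
        ... | inj₁ lt = B.trans (B.reflexive (extVal-< j u (gT u) p c lt (ℕₚ.<⇒≢ lt)))
                (B.trans (B.op-cong _ (B.sym (gT-unique u)) eq)
                  (B.trans (B.sym (h.hom (j , _) _ _)) (B.reflexive (≡.cong h (gen-app j u (κH p))))))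
        ... | inj₂ e₀ = B.trans (B.reflexive (extVal-≡ j u (gT u) p c e₀)) (B.sym (h-κ (ext j e₀ u p)))
        go : q < ρ j ⊎ ρ j ≤ q → ψ (gen (wk u) ⊙⟨ j ⟩ gen v) N.≈ loop N f (app j le u v)
        go (inj₁ hi)  = N.trans (act-hom (j , ℕₚ.>⇒≢ hi) hi _ _) (N.trans (N.act-cong _ IHu hv)
          (N.reflexive (≡.sym (loop-high N f j {le} u v hi (ℕₚ.>⇒≢ hi)))))
        go (inj₂ j≤q) = N.trans (N.reflexive (≡.cong (λ t → ψ (gen (wk u) ⊙⟨ j ⟩ gen t)) (≡.sym (wk-id v))))
          (N.trans (proj₁ (loop-unique N′ {f = inner f j j≤q u (gT u)} Ψ′ (act-hom′ j≤q) (λ p c eq →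
                    N.trans (N.reflexive (≡.cong ψ (gen-app j u (κH p)))) (e (app j j≤q u p) _ (extVal-κ p c j≤q eq))
                    , B.sym eq) v))
            (N.reflexive (≡.sym (loop-low N f j {le} u v j≤q))))

      g-unique : ∀ m → h m B.≈ g m
      g-unique = additive-ext B.group h.additive g-additive
        (λ t → B.trans (B.reflexive (≡.cong (λ t → h (gen t)) (≡.sym (wk-id t)))) (gT-unique t))

-- Forgetting all operations outside S

module _ {a : Level} (S : ℕ → Set) where

  -- An isomorphism onto another algebra of trees that respects only the kept operations. Since the
  -- target is again of the form `Trees`, such steps compose, and `inc-ρ` preserves the original
  -- ranks.
  record Reduction (𝕀 : Index) (X : Set a) : Set (lsuc a) where
    open Index 𝕀
    module A = Trees 𝕀 X
    field
      𝕀*   : Index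
      Y    : Set a
    open Index 𝕀* using () renaming (I to I*; ρ to ρ*) public
    module A* = Trees 𝕀* Y
    field
      inc      : I* → I
      inc-ρ    : ∀ i → ρ (inc i) ≡ ρ* i
      sound    : ∀ i → S (ρ* i)
      complete : ∀ {k} → S k → Σ I* λ i → ρ* i ≡ k
      to       : A.FA → A*.FA
      from     : A*.FA → A.FA
      to-additive   : Additive A.FAgroup A*.FAgroup to
      from-additive : Additive A*.FAgroup A.FAgroup from
      to-hom   : ∀ i m d → to (m A.⊙⟨ inc i ⟩ d) A*.≋ to m A*.⊙⟨ i ⟩ to d
      from-hom : ∀ i m d → from (m A*.⊙⟨ i ⟩ d) A.≋ from m A.⊙⟨ inc i ⟩ from d
      to-from  : ∀ m → to (from m) A*.≋ m
      from-to  : ∀ m → from (to m) A.≋ m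

  additive-id : ∀ {g ℓ} (G : AbelianGroup g ℓ) → Additive G G (λ x → x)
  additive-id G = record { f-cong = λ p → p ; f-+ = λ _ _ → AbelianGroup.refl G }

  trivialReduction : ∀ 𝕀 X → (∀ i → S (Index.ρ 𝕀 i)) → (∀ {k} → S k → Σ (Index.I 𝕀) λ i → Index.ρ 𝕀 i ≡ k) →
                     Reduction 𝕀 X
  trivialReduction 𝕀 X sound complete = record
    { 𝕀* = 𝕀 ; Y = X ; inc = λ i → i ; inc-ρ = λ _ → ≡.refl ; sound = sound ; complete = complete
    ; to = λ m → m ; from = λ m → m ; to-additive = additive-id _ ; from-additive = additive-id _
    ; to-hom = λ _ _ _ → ≋-refl ; from-hom = λ _ _ _ → ≋-refl
    ; to-from = λ _ → ≋-refl ; from-to = λ _ → ≋-refl }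
    where open Trees 𝕀 X

  module _ (𝕀 : Index) (q : ℕ) (0<q : 0 < q) (X : Set a) where
    open Merge 𝕀 q 0<q X hiding (Y)
    private
      module A = Trees 𝕀 X
      module A′ = Trees 𝕁 (Merge.Y 𝕀 q 0<q X)
      module To = Extend A′.treeAlg (λ y → A′.gen (A′.leaf y))
      R : Alg 𝕁 a a
      R = restrict 0<q A.treeAlg
      module Back = Extend R (λ y → A.gen (κ y))

      from : A′.FA → A.FA
      from = A′.ev R (λ y → A.gen (κ y))

      from-isHom : A′.IsHom R from
      from-isHom = A′.ev-isHom R (λ y → A.gen (κ y))

      module F = A′.IsHom from-isHom
      module G = To.IsRestrictedHom To.g-isHom

      to-from : ∀ m → To.g (from m) A′.≋ m
      to-from = A′.hom-ext A′.treeAlg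
        (record { additive = additive-∘ To.g-additive F.additive
                ; hom = λ k m d → A′.≋-trans (G.f-cong (F.hom k m d)) (G.hom k (from m) (from d)) })
        (record { additive = additive-id _ ; hom = λ _ _ _ → A′.≋-refl })
        (λ y → Alg.reflexive A′.treeAlg (To.g-κ y))

      -- The composite and the identity are both homomorphisms for the remaining operations and
      -- agree on every `κ y`, so `Back.g-unique` equates both with `Back.g`.
      from-to : ∀ m → from (To.g m) A.≋ m
      from-to m = A.≋-trans
        (Back.g-unique (record { additive = additive-∘ F.additive To.g-additive
                               ; hom = λ k m d → A.≋-trans (F.f-cong (G.hom k m d)) (F.hom k (To.g m) (To.g d)) })
          (λ y → Alg.reflexive A.treeAlg (≡.cong from (To.g-κ y))) m)
        (A.≋-sym (Back.g-unique (record { additive = additive-id _ ; hom = λ _ _ _ → A.≋-refl })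
          (λ _ → A.≋-refl) m))

    removeReduction : Reduction 𝕁 (Merge.Y 𝕀 q 0<q X) → Reduction 𝕀 X
    removeReduction r = record
      { 𝕀* = r.𝕀* ; Y = r.Y ; inc = λ i → proj₁ (r.inc i) ; inc-ρ = r.inc-ρ
      ; sound = r.sound ; complete = r.complete
      ; to = λ m → r.to (To.g m) ; from = λ m → from (r.from m)
      ; to-additive = additive-∘ r.to-additive To.g-additive
      ; from-additive = additive-∘ F.additive r.from-additive
      ; to-hom = λ i m d → r.A*.≋-trans (Additive.f-cong r.to-additive (G.hom (r.inc i) m d)) (r.to-hom i _ _)
      ; from-hom = λ i m d → A.≋-trans (F.f-cong (r.from-hom i m d)) (F.hom (r.inc i) (r.from m) (r.from d))
      ; to-from = λ m → r.A*.≋-trans (Additive.f-cong r.to-additive (to-from _)) (r.to-from m)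
      ; from-to = λ m → A.≋-trans (F.f-cong (r.from-to _)) (from-to m) }
      where module r = Reduction r

  module _ (S? : ∀ k → Dec (S k)) where

    -- By `cover`, rank 0 and all ranks above n are already in S. Rank n is then kept or removed;
    -- after a removal the new generators take the place of X.
    reduction : ∀ n 𝕀 X → (∀ i → (0 < Index.ρ 𝕀 i × Index.ρ 𝕀 i ≤ n) ⊎ S (Index.ρ 𝕀 i)) →
                (∀ {k} → S k → Σ (Index.I 𝕀) λ i → Index.ρ 𝕀 i ≡ k) → Reduction 𝕀 X
    reduction zero 𝕀 X cover complete = trivialReduction 𝕀 X sound complete
      where
      sound : ∀ i → S (Index.ρ 𝕀 i)
      sound i with cover i
      ... | inj₁ (p , r) = ⊥-elim (ℕₚ.<⇒≱ p r)
      ... | inj₂ s       = s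
    reduction (suc n) 𝕀 X cover complete with S? (suc n)
    ... | yes s = reduction n 𝕀 X cover′ complete
      where
      cover′ : ∀ i → (0 < Index.ρ 𝕀 i × Index.ρ 𝕀 i ≤ n) ⊎ S (Index.ρ 𝕀 i)
      cover′ i with cover i
      ... | inj₂ s′ = inj₂ s′
      ... | inj₁ (p , r) with ℕₚ.m≤n⇒m<n∨m≡n r
      ...   | inj₁ (s≤s r′) = inj₁ (p , r′)
      ...   | inj₂ e        = inj₂ (≡.subst S (≡.sym e) s)
    ... | no ¬s = removeReduction 𝕀 (suc n) (s≤s z≤n) X (reduction n _ _ cover′ complete′)
      where
      cover′ : ∀ i → (0 < Index.ρ 𝕀 (proj₁ i) × Index.ρ 𝕀 (proj₁ i) ≤ n) ⊎ S (Index.ρ 𝕀 (proj₁ i))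
      cover′ (i , ≢q) with cover i
      ... | inj₂ s       = inj₂ s
      ... | inj₁ (p , r) = inj₁ (p , ℕₚ.<⇒≤pred (ℕₚ.≤∧≢⇒< r ≢q))
      complete′ : ∀ {k} → S k → Σ (Σ (Index.I 𝕀) λ i → Index.ρ 𝕀 i ≢ suc n) λ i → Index.ρ 𝕀 (proj₁ i) ≡ k
      complete′ s with complete s
      ... | i , e = (i , λ e′ → ¬s (≡.subst S (≡.trans (≡.sym e) e′) s)) , e

-- The operations ⊙ₖ of a Dyck algebra

module Linear {c ℓ} (K : Field c ℓ) where

  open Field K using (commutativeRing) renaming (Carrier to Kc)

  VSpace : ∀ a ℓa → Set (c ⊔ ℓ ⊔ lsuc (a ⊔ ℓa))
  VSpace a ℓa = Module commutativeRing a ℓa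

  module VS {a ℓa} (V : VSpace a ℓa) where
    open Ab (Module.+ᴹ-abelianGroup V) public
    open Module V public using (_*ₗ_; *ₗ-cong; *ₗ-distribˡ; *ₗ-zeroʳ)
    open Field K using () renaming (refl to K-refl) public

    *ₗ-additive : ∀ k → Additive (Module.+ᴹ-abelianGroup V) (Module.+ᴹ-abelianGroup V) (k *ₗ_)
    *ₗ-additive k = record { f-cong = *ₗ-cong K-refl ; f-+ = *ₗ-distribˡ k }

  record IsLinear {a ℓa b ℓb} (V : VSpace a ℓa) (W : VSpace b ℓb)
                  (f : Module.Carrierᴹ V → Module.Carrierᴹ W) : Set (c ⊔ a ⊔ ℓa ⊔ b ⊔ ℓb) where
    no-eta-equality
    private
      module V = VS V
      module W = VS W
    field
      additive : Additive (Module.+ᴹ-abelianGroup V) (Module.+ᴹ-abelianGroup W) f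
      f-*      : ∀ (k : Kc) x → f (k V.*ₗ x) W.≈ k W.*ₗ f x
    open Additive additive public

  module _ {a ℓa b ℓb} {V : VSpace a ℓa} {W : VSpace b ℓb} where
    private module W = VS W

    linear-+ : ∀ {f g} → IsLinear V W f → IsLinear V W g → IsLinear V W (λ x → f x W.+ g x)
    linear-+ F G = record
      { additive = additive-+ (IsLinear.additive F) (IsLinear.additive G)
      ; f-* = λ k x → W.trans (W.+-cong (IsLinear.f-* F k x) (IsLinear.f-* G k x)) (W.sym (W.*ₗ-distribˡ k _ _)) }

    linear-sub : ∀ {f g} → IsLinear V W f → IsLinear V W g → IsLinear V W (λ x → f x W.- g x)
    linear-sub F G = record
      { additive = additive-sub (IsLinear.additive F) (IsLinear.additive G)
      ; f-* = λ k x → W.trans (W.sub-cong (IsLinear.f-* F k x) (IsLinear.f-* G k x))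
                              (W.sym (Additive.f-sub (W.*ₗ-additive k) _ _)) }

    linear-0 : IsLinear V W (λ _ → W.0#)
    linear-0 = record
      { additive = record { f-cong = λ _ → W.refl ; f-+ = λ _ _ → W.sym (W.+-identityˡ _) }
      ; f-* = λ k _ → W.sym (W.*ₗ-zeroʳ k) }

    linear-* : ∀ k {f} → IsLinear V W f → IsLinear V W (λ x → k W.*ₗ f x)
    linear-* k F = record
      { additive = additive-∘ (W.*ₗ-additive k) (IsLinear.additive F)
      ; f-* = λ l x → W.trans (W.*ₗ-cong W.K-refl (IsLinear.f-* F l x)) (swap k l _) }
      where
      open Module W using (*ₗ-assoc)
      swap : ∀ k l x → k W.*ₗ (l W.*ₗ x) W.≈ l W.*ₗ (k W.*ₗ x)
      swap k l x = W.trans (W.sym (*ₗ-assoc k l x)) (W.trans (W.*ₗ-cong (Field.*-comm K k l) W.refl) (*ₗ-assoc l k x))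

  linear-∘ : ∀ {a ℓa b ℓb d ℓd} {U : VSpace a ℓa} {V : VSpace b ℓb} {W : VSpace d ℓd} {g f} →
             IsLinear V W g → IsLinear U V f → IsLinear U W (λ x → g (f x))
  linear-∘ {W = W} G F = record
    { additive = additive-∘ (IsLinear.additive G) (IsLinear.additive F)
    ; f-* = λ k x → VS.trans W (IsLinear.f-cong G (IsLinear.f-* F k x)) (IsLinear.f-* G k _) }

  linear-id : ∀ {a ℓa} {V : VSpace a ℓa} → IsLinear V V (λ x → x)
  linear-id {V = V} = record
    { additive = record { f-cong = λ p → p ; f-+ = λ _ _ → VS.refl V } ; f-* = λ _ _ → VS.refl V }

  record IsBilinear {a ℓa} {b ℓb} (V : VSpace a ℓa) (W : VSpace b ℓb)
                    (β : Module.Carrierᴹ V → Module.Carrierᴹ V → Module.Carrierᴹ W) : Set (c ⊔ a ⊔ ℓa ⊔ b ⊔ ℓb) where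
    no-eta-equality
    field
      linˡ : ∀ y → IsLinear V W (λ x → β x y)
      linʳ : ∀ x → IsLinear V W (β x)
    private
      module V = VS V
      module W = VS W
    β-cong : ∀ {x x′ y y′} → x V.≈ x′ → y V.≈ y′ → β x y W.≈ β x′ y′
    β-cong {y = y} p q = W.trans (IsLinear.f-cong (linˡ y) p) (IsLinear.f-cong (linʳ _) q)

  -- ⊙ k plays the role of *ₖ + … + *ₘ.
  record Ops {a ℓa} (V : VSpace a ℓa) (m : ℕ) : Set (c ⊔ a ⊔ ℓa) where
    no-eta-equality
    open VS V
    field
      ⊙        : ℕ → Carrier → Carrier → Carrier
      bilinear : ∀ k → IsBilinear V V (⊙ k)
      vanish   : ∀ {k} → m < k → ∀ x y → ⊙ k x y ≈ 0#
      rel      : ∀ {i k} → i ≤ k → ∀ x y z →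
                 ⊙ k (⊙ i x y) z ≈ ⊙ i x (⊙ k y z) + ⊙ k x (⊙ 0 y z - ⊙ k y z)
    module _ (k : ℕ) where
      open IsBilinear (bilinear k) public renaming (linˡ to ⊙-linˡ; linʳ to ⊙-linʳ; β-cong to ⊙-cong)

  reindex : ∀ {a ℓa} {V : VSpace a ℓa} {m s} (O : Ops V m) (φ : ℕ → ℕ) → φ 0 ≡ 0 →
            (∀ {i k} → i ≤ k → φ i ≤ φ k) → (∀ {k} → s < k → m < φ k) → Ops V s
  reindex {V = V} O φ φ0 mono big = record
    { ⊙ = λ k → O.⊙ (φ k) ; bilinear = λ k → O.bilinear (φ k)
    ; vanish = λ p → O.vanish (big p)
    ; rel = λ {i} {k} p x y z → ≡.subst
        (λ w → O.⊙ (φ k) (O.⊙ (φ i) x y) z ≈ O.⊙ (φ i) x (O.⊙ (φ k) y z) + O.⊙ (φ k) x (O.⊙ w y z - O.⊙ (φ k) y z))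
        (≡.sym φ0) (O.rel (mono p) x y z) }
    where
    module O = Ops O
    open VS V

  module Str {l a ℓa} (A : DyckStr K l a ℓa) where
    open DyckStr A using (vecSpace; op; opℕ; sumFrom; sumRange)
    open VS vecSpace

    opℕ-toℕ : ∀ i x y → opℕ (toℕ i) x y ≈ op i x y
    opℕ-toℕ i x y with toℕ i <? suc l
    ... | yes p = reflexive (≡.cong (λ j → op j x y) (Finₚ.fromℕ<-toℕ i p))
    ... | no ¬p = ⊥-elim (¬p (Finₚ.toℕ<n i))

    opℕ-big : ∀ {k} → l < k → ∀ x y → opℕ k x y ≈ 0#
    opℕ-big {k} p x y with k <? suc l
    ... | yes q = ⊥-elim (ℕₚ.<⇒≱ p (ℕₚ.≤-pred q))
    ... | no _  = refl

    sumFrom-cong : ∀ b n {f g} → (∀ j → b ≤ j → j < b ℕ.+ n → f j ≈ g j) → sumFrom b n f ≈ sumFrom b n g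
    sumFrom-cong b zero e    = refl
    sumFrom-cong b (suc n) e = +-cong (e b ℕₚ.≤-refl (ℕₚ.m<m+n b (s≤s z≤n)))
      (sumFrom-cong (suc b) n λ j p q → e j (ℕₚ.<⇒≤ p) (≡.subst (j <_) (≡.sym (ℕₚ.+-suc b n)) q))

    telescope : ∀ b n (h : ℕ → Carrier) → sumFrom b n (λ j → h j - h (suc j)) ≈ h b - h (b ℕ.+ n)
    telescope b zero h    = trans (sym (-‿inverseʳ (h b))) (reflexive (≡.cong (λ b′ → h b - h b′) (≡.sym (ℕₚ.+-identityʳ b))))
    telescope b (suc n) h = trans (+-cong refl (telescope (suc b) n h))
      (trans (solve ((v0 ⊝ v1) ⊕ (v1 ⊝ v2)) (v0 ⊝ v2) ≡.refl (_ ∷ _ ∷ _ ∷ []))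
             (reflexive (≡.cong (λ b′ → h b - h b′) (≡.sym (ℕₚ.+-suc b n)))))

    additive-sumFrom : ∀ {g} → Additive (Module.+ᴹ-abelianGroup vecSpace) (Module.+ᴹ-abelianGroup vecSpace) g →
                       ∀ b n f → g (sumFrom b n f) ≈ sumFrom b n (λ j → g (f j))
    additive-sumFrom G b zero f    = Additive.f-0 G
    additive-sumFrom G b (suc n) f = trans (Additive.f-+ G _ _) (+-cong refl (additive-sumFrom G (suc b) n f))

    linear-sumFrom : ∀ {b ℓb} {W : VSpace b ℓb} (φ : ℕ → Module.Carrierᴹ W → Carrier) →
                     (∀ j → IsLinear W vecSpace (φ j)) → ∀ b n → IsLinear W vecSpace (λ w → sumFrom b n (λ j → φ j w))
    linear-sumFrom φ Φ b zero    = linear-0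
    linear-sumFrom φ Φ b (suc n) = linear-+ (Φ b) (linear-sumFrom φ Φ (suc b) n)

    tail : ℕ → Carrier → Carrier → Carrier
    tail k x y = sumFrom k (suc l ∸ k) (λ j → opℕ j x y)

    tail-big : ∀ {k} → l < k → ∀ x y → tail k x y ≈ 0#
    tail-big {k} p x y = reflexive (≡.cong (λ n → sumFrom k n (λ j → opℕ j x y)) (ℕₚ.m≤n⇒m∸n≡0 p))

    tail-suc : ∀ k x y → tail k x y ≈ opℕ k x y + tail (suc k) x y
    tail-suc k x y = go (ℕₚ.≤-<-connex k l)
      where
      go : k ≤ l ⊎ l < k → tail k x y ≈ opℕ k x y + tail (suc k) x y
      go (inj₁ p) = reflexive (≡.cong (λ n → sumFrom k n (λ j → opℕ j x y)) (ℕₚ.+-∸-assoc 1 p))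
      go (inj₂ p) = trans (tail-big p x y)
        (sym (trans (+-cong (opℕ-big p x y) (tail-big (ℕₚ.m≤n⇒m≤1+n p) x y)) (+-identityˡ _)))

    opℕ-tail : ∀ k x y → opℕ k x y ≈ tail k x y - tail (suc k) x y
    opℕ-tail k x y = sym (trans (sub-cong (tail-suc k x y) refl)
      (solve ((v0 ⊕ v1) ⊝ v1) v0 ≡.refl (_ ∷ _ ∷ [])))

    module _ (isDyck : IsDyckAlgebra K A) where
      open IsDyckAlgebra isDyck

      opℕ-bilinear : ∀ k → IsBilinear vecSpace vecSpace (opℕ k)
      opℕ-bilinear k with k <? suc l
      ... | yes p = record
        { linˡ = λ y → record
          { additive = record { f-cong = λ e → op-cong _ e refl ; f-+ = λ x x′ → op-+ˡ _ x x′ y }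
          ; f-* = λ k x → op-*ˡ _ k x y }
        ; linʳ = λ x → record
          { additive = record { f-cong = op-cong _ refl ; f-+ = op-+ʳ _ x }
          ; f-* = λ k y → op-*ʳ _ k x y } }
      ... | no _ = record { linˡ = λ _ → linear-0 ; linʳ = λ _ → linear-0 }

      module _ (k : ℕ) where
        open IsBilinear (opℕ-bilinear k) public using () renaming (linˡ to opℕ-linˡ; linʳ to opℕ-linʳ; β-cong to opℕ-cong)

      tail-bilinear : ∀ k → IsBilinear vecSpace vecSpace (tail k)
      tail-bilinear k = record
        { linˡ = λ y → linear-sumFrom (λ j x → opℕ j x y) (λ j → opℕ-linˡ j y) k (suc l ∸ k)
        ; linʳ = λ x → linear-sumFrom (λ j y → opℕ j x y) (λ j → opℕ-linʳ j x) k (suc l ∸ k) }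

      module _ (k : ℕ) where
        open IsBilinear (tail-bilinear k) public using () renaming (linˡ to tail-linˡ; linʳ to tail-linʳ; β-cong to tail-cong)

      private
        fin : ∀ {k} → k ≤ l → Fin (suc l)
        fin p = fromℕ< (s≤s p)

        toℕ-fin : ∀ {k} (p : k ≤ l) → toℕ (fin p) ≡ k
        toℕ-fin p = Finₚ.toℕ-fromℕ< (s≤s p)

        opℕ-fin : ∀ {k} (p : k ≤ l) x y → opℕ k x y ≈ op (fin p) x y
        opℕ-fin p x y = trans (reflexive (≡.cong (λ j → opℕ j x y) (≡.sym (toℕ-fin p)))) (opℕ-toℕ (fin p) x y)

      dyck₁ℕ : ∀ {i j} → i < j → ∀ x y z → opℕ i x (opℕ j y z) ≈ opℕ j (opℕ i x y) z
      dyck₁ℕ {i} {j} i<j x y z = go (ℕₚ.≤-<-connex j l)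
        where
        go : j ≤ l ⊎ l < j → opℕ i x (opℕ j y z) ≈ opℕ j (opℕ i x y) z
        go (inj₂ p) = trans (opℕ-cong i refl (opℕ-big p y z))
          (trans (IsLinear.f-0 (opℕ-linʳ i x)) (sym (opℕ-big p _ z)))
        go (inj₁ p) = begin
          opℕ i x (opℕ j y z)                ≈⟨ trans (opℕ-cong i refl (opℕ-fin p y z)) (opℕ-fin q x _) ⟩
          op (fin q) x (op (fin p) y z)      ≈⟨ dyck₁ (fin q) (fin p) lt x y z ⟩
          op (fin p) (op (fin q) x y) z      ≈⟨ trans (opℕ-cong j (opℕ-fin q x y) refl) (opℕ-fin p _ z) ⟨
          opℕ j (opℕ i x y) z ∎
          where
          q : i ≤ l
          q = ℕₚ.≤-trans (ℕₚ.<⇒≤ i<j) p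
          lt : toℕ (fin q) < toℕ (fin p)
          lt = ≡.subst₂ _<_ (≡.sym (toℕ-fin q)) (≡.sym (toℕ-fin p)) i<j

      opℕ-tail-assoc : ∀ {i k} → i < k → ∀ x y z → opℕ i x (tail k y z) ≈ tail k (opℕ i x y) z
      opℕ-tail-assoc {i} {k} i<k x y z = trans
        (additive-sumFrom (IsLinear.additive (opℕ-linʳ i x)) k (suc l ∸ k) (λ j → opℕ j y z))
        (sumFrom-cong k (suc l ∸ k) λ j p _ → dyck₁ℕ (ℕₚ.<-≤-trans i<k p) x y z)

      -- The second family of Dyck axioms in tail form: writing *ⱼ as ⊙ⱼ - ⊙ⱼ₊₁ makes the sum over j
      -- ≤ i telescope, and the sum over k ≥ i is a tail.
      tail-opℕ : ∀ i x y z → opℕ i x (tail 0 y z) - opℕ i x (tail (suc i) y z) ≈ opℕ i (tail i x y) z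
      tail-opℕ i x y z = go (ℕₚ.≤-<-connex i l)
        where
        go : i ≤ l ⊎ l < i → opℕ i x (tail 0 y z) - opℕ i x (tail (suc i) y z) ≈ opℕ i (tail i x y) z
        go (inj₂ p) = trans (sub-cong (opℕ-big p _ _) (opℕ-big p _ _))
          (trans (-‿inverseʳ 0#) (sym (opℕ-big p _ _)))
        go (inj₁ p) = begin
          opℕ i x (tail 0 y z) - opℕ i x (tail (suc i) y z)
            ≈⟨ telescope 0 (suc i) (λ j → opℕ i x (tail j y z)) ⟨
          sumFrom 0 (suc i) (λ j → opℕ i x (tail j y z) - opℕ i x (tail (suc j) y z))
            ≈⟨ sumFrom-cong 0 (suc i) (λ j _ _ → trans (sym (IsLinear.f-sub (opℕ-linʳ i x) _ _))
                 (opℕ-cong i refl (sym (opℕ-tail j y z)))) ⟩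
          sumFrom 0 (suc i) (λ j → opℕ i x (opℕ j y z))
            ≈⟨ ≡.subst (λ n → sumFrom 0 (suc n) (λ j → opℕ n x (opℕ j y z)) ≈
                              sumFrom n (suc l ∸ n) (λ k → opℕ n (opℕ k x y) z)) (toℕ-fin p) main ⟩
          sumFrom i (suc l ∸ i) (λ k → opℕ i (opℕ k x y) z)
            ≈⟨ additive-sumFrom (IsLinear.additive (opℕ-linˡ i z)) i (suc l ∸ i) _ ⟨
          opℕ i (tail i x y) z ∎
          where
          f = fin p
          main : sumFrom 0 (suc (toℕ f)) (λ j → opℕ (toℕ f) x (opℕ j y z)) ≈
                 sumFrom (toℕ f) (suc l ∸ toℕ f) (λ k → opℕ (toℕ f) (opℕ k x y) z)
          main = trans (sumFrom-cong 0 (suc (toℕ f)) λ j _ _ → opℕ-toℕ f x (opℕ j y z))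
            (trans (dyck₂ f x y z) (sym (sumFrom-cong (toℕ f) (suc l ∸ toℕ f) λ j _ _ → opℕ-toℕ f (opℕ j x y) z)))

      private
        -- Downward induction on k, with n bounding the number of remaining operations. Splitting
        -- off *ₖ, the term x *ₖ (y ⊙ₖ₊₁ z) comes with a minus sign from `tail-opℕ` and a plus sign
        -- from `opℕ-tail-assoc`.
        tail-kk : ∀ n k → suc l ≤ k ℕ.+ n → ∀ x y z → tail k (tail k x y) z ≈ tail k x (tail 0 y z)
        tail-kk zero k p x y z = trans (tail-big p′ _ _) (sym (tail-big p′ _ _))
          where p′ = ≡.subst (suc l ≤_) (ℕₚ.+-identityʳ k) p
        tail-kk (suc n) k p x y z = begin
          tail k (tail k x y) z
            ≈⟨ tail-suc k _ z ⟩
          opℕ k (tail k x y) z + tail (suc k) (tail k x y) z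
            ≈⟨ +-cong (sym (tail-opℕ k x y z)) (trans (tail-cong (suc k) (tail-suc k x y) refl)
                 (IsLinear.f-+ (tail-linˡ (suc k) z) _ _)) ⟩
          (opℕ k x (tail 0 y z) - opℕ k x (tail (suc k) y z))
            + (tail (suc k) (opℕ k x y) z + tail (suc k) (tail (suc k) x y) z)
            ≈⟨ +-cong refl (+-cong (sym (opℕ-tail-assoc {k} {suc k} ℕₚ.≤-refl x y z))
                 (tail-kk n (suc k) (≡.subst (suc l ≤_) (ℕₚ.+-suc k n) p) x y z)) ⟩
          (opℕ k x (tail 0 y z) - opℕ k x (tail (suc k) y z))
            + (opℕ k x (tail (suc k) y z) + tail (suc k) x (tail 0 y z))
            ≈⟨ solve ((v0 ⊝ v1) ⊕ (v1 ⊕ v2)) (v0 ⊕ v2) ≡.refl (_ ∷ _ ∷ _ ∷ []) ⟩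
          opℕ k x (tail 0 y z) + tail (suc k) x (tail 0 y z)
            ≈⟨ tail-suc k x _ ⟨
          tail k x (tail 0 y z) ∎

        -- Induction on n = k - i, splitting *ᵢ off ⊙ᵢ; it passes through ⊙ₖ because i < k. For i =
        -- k the two right factors add up to y ⊙₀ z, which is `tail-kk`.
        tail-ik : ∀ n i → ∀ x y z → (let k = n ℕ.+ i) →
                  tail k (tail i x y) z ≈ tail i x (tail k y z) + tail k x (tail 0 y z - tail k y z)
        tail-ik zero i x y z = trans (tail-kk (suc l) i (ℕₚ.m≤n+m (suc l) i) x y z)
          (trans (tail-cong i refl (solve v0 (v1 ⊕ (v0 ⊝ v1)) ≡.refl (_ ∷ tail i y z ∷ [])))
                 (IsLinear.f-+ (tail-linʳ i x) _ _))
        tail-ik (suc n) i x y z = begin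
          tail k (tail i x y) z
            ≈⟨ trans (tail-cong k (tail-suc i x y) refl) (IsLinear.f-+ (tail-linˡ k z) _ _) ⟩
          tail k (opℕ i x y) z + tail k (tail (suc i) x y) z
            ≈⟨ +-cong (sym (opℕ-tail-assoc (s≤s (ℕₚ.m≤n+m i n)) x y z)) IH ⟩
          opℕ i x (tail k y z) + (tail (suc i) x (tail k y z) + tail k x (tail 0 y z - tail k y z))
            ≈⟨ +-assoc _ _ _ ⟨
          opℕ i x (tail k y z) + tail (suc i) x (tail k y z) + tail k x (tail 0 y z - tail k y z)
            ≈⟨ +-cong (tail-suc i x _) refl ⟨
          tail i x (tail k y z) + tail k x (tail 0 y z - tail k y z) ∎
          where
          k = suc n ℕ.+ i
          IH : tail k (tail (suc i) x y) z ≈ tail (suc i) x (tail k y z) + tail k x (tail 0 y z - tail k y z)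
          IH = ≡.subst (λ k → tail k (tail (suc i) x y) z ≈
                              tail (suc i) x (tail k y z) + tail k x (tail 0 y z - tail k y z))
                       (ℕₚ.+-suc n i) (tail-ik n (suc i) x y z)

      tailOps : Ops vecSpace l
      tailOps = record
        { ⊙ = tail ; bilinear = tail-bilinear ; vanish = tail-big
        ; rel = λ {i} {k} i≤k x y z → ≡.subst
            (λ k → tail k (tail i x y) z ≈ tail i x (tail k y z) + tail k x (tail 0 y z - tail k y z))
            (ℕₚ.m∸n+n≡m i≤k) (tail-ik (k ∸ i) i x y z) }

    module _ (O : Ops vecSpace l) (op-⊙ : ∀ i x y → op i x y ≈ Ops.⊙ O (toℕ i) x y - Ops.⊙ O (suc (toℕ i)) x y) where
      private
        module O = Ops O
        open O using (⊙; ⊙-linˡ; ⊙-linʳ; ⊙-cong)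

        st : ℕ → Carrier → Carrier → Carrier
        st i x y = ⊙ i x y - ⊙ (suc i) x y

        st-linˡ : ∀ i y → IsLinear vecSpace vecSpace (λ x → st i x y)
        st-linˡ i y = linear-sub (⊙-linˡ i y) (⊙-linˡ (suc i) y)
        st-linʳ : ∀ i x → IsLinear vecSpace vecSpace (st i x)
        st-linʳ i x = linear-sub (⊙-linʳ i x) (⊙-linʳ (suc i) x)
        st-cong : ∀ i {x x′ y y′} → x ≈ x′ → y ≈ y′ → st i x y ≈ st i x′ y′
        st-cong i p q = sub-cong (⊙-cong i p q) (⊙-cong (suc i) p q)

        -- The relations for i and i + 1 against k have the same correction term `C`; this needs i +
        -- 1 ≤ k.
        st-⊙ : ∀ {i k} → i < k → ∀ x y z → st i x (⊙ k y z) ≈ ⊙ k (st i x y) z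
        st-⊙ {i} {k} i<k x y z = sym (begin
          ⊙ k (st i x y) z                          ≈⟨ IsLinear.f-sub (⊙-linˡ k z) _ _ ⟩
          ⊙ k (⊙ i x y) z - ⊙ k (⊙ (suc i) x y) z   ≈⟨ sub-cong (O.rel (ℕₚ.<⇒≤ i<k) x y z) (O.rel i<k x y z) ⟩
          (⊙ i x (⊙ k y z) + C) - (⊙ (suc i) x (⊙ k y z) + C)
            ≈⟨ solve ((v0 ⊕ v1) ⊝ (v2 ⊕ v1)) (v0 ⊝ v2) ≡.refl (_ ∷ _ ∷ _ ∷ []) ⟩
          st i x (⊙ k y z) ∎)
          where C = ⊙ k x (⊙ 0 y z - ⊙ k y z)

        st-st : ∀ {i k} → i < k → ∀ x y z → st i x (st k y z) ≈ st k (st i x y) z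
        st-st i<k x y z = trans (IsLinear.f-sub (st-linʳ _ x) _ _)
          (sub-cong (st-⊙ i<k x y z) (st-⊙ (ℕₚ.m≤n⇒m≤1+n i<k) x y z))

        st-assoc : ∀ i x y z → st i x (⊙ 0 y z) - st i x (⊙ (suc i) y z) ≈ st i (⊙ i x y) z
        st-assoc i x y z = sym (begin
          ⊙ i (⊙ i x y) z - ⊙ i′ (⊙ i x y) z
            ≈⟨ sub-cong (trans (O.rel ℕₚ.≤-refl x y z) (+-cong refl (IsLinear.f-sub (⊙-linʳ i x) _ _)))
                        (trans (O.rel (ℕₚ.n≤1+n i) x y z) (+-cong refl (IsLinear.f-sub (⊙-linʳ i′ x) _ _))) ⟩
          (⊙ i x (⊙ i y z) + (⊙ i x (⊙ 0 y z) - ⊙ i x (⊙ i y z)))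
            - (⊙ i x (⊙ i′ y z) + (⊙ i′ x (⊙ 0 y z) - ⊙ i′ x (⊙ i′ y z)))
            ≈⟨ solve ((v0 ⊕ (v1 ⊝ v0)) ⊝ (v2 ⊕ (v3 ⊝ v4))) ((v1 ⊝ v3) ⊝ (v2 ⊝ v4)) ≡.refl (_ ∷ _ ∷ _ ∷ _ ∷ _ ∷ []) ⟩
          st i x (⊙ 0 y z) - st i x (⊙ (suc i) y z) ∎)
          where i′ = suc i

      opℕ-⊙ : ∀ k x y → opℕ k x y ≈ ⊙ k x y - ⊙ (suc k) x y
      opℕ-⊙ k x y = go (ℕₚ.≤-<-connex k l)
        where
        go : k ≤ l ⊎ l < k → opℕ k x y ≈ st k x y
        go (inj₁ p) = ≡.subst (λ k → opℕ k x y ≈ st k x y) (Finₚ.toℕ-fromℕ< (s≤s p))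
          (trans (opℕ-toℕ (fromℕ< (s≤s p)) x y) (op-⊙ (fromℕ< (s≤s p)) x y))
        go (inj₂ p) = trans (opℕ-big p x y) (sym (trans (sub-cong (O.vanish p x y) (O.vanish (ℕₚ.m≤n⇒m≤1+n p) x y)) (-‿inverseʳ 0#)))

      tail-⊙ : ∀ k x y → tail k x y ≈ ⊙ k x y
      tail-⊙ k x y = go (ℕₚ.≤-<-connex k (suc l))
        where
        go : k ≤ suc l ⊎ suc l < k → tail k x y ≈ ⊙ k x y
        go (inj₂ p) = trans (tail-big (ℕₚ.<⇒≤ p) x y) (sym (O.vanish (ℕₚ.<⇒≤ p) x y))
        go (inj₁ p) = begin
          tail k x y                                            ≈⟨ sumFrom-cong k (suc l ∸ k) (λ j _ _ → opℕ-⊙ j x y) ⟩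
          sumFrom k (suc l ∸ k) (λ j → ⊙ j x y - ⊙ (suc j) x y)   ≈⟨ telescope k _ (λ j → ⊙ j x y) ⟩
          ⊙ k x y - ⊙ (k ℕ.+ (suc l ∸ k)) x y
            ≈⟨ sub-cong refl (trans (reflexive (≡.cong (λ j → ⊙ j x y) (ℕₚ.m+[n∸m]≡n p))) (O.vanish ℕₚ.≤-refl x y)) ⟩
          ⊙ k x y - 0#                                          ≈⟨ solve (v0 ⊝ ze) v0 ≡.refl (_ ∷ []) ⟩
          ⊙ k x y ∎

      ops⇒isDyck : IsDyckAlgebra K A
      ops⇒isDyck = record
        { op-cong = λ i p q → trans (op-⊙ i _ _) (trans (st-cong (toℕ i) p q) (sym (op-⊙ i _ _)))
        ; op-+ˡ = λ i x x′ y → trans (op-⊙ i _ _) (trans (IsLinear.f-+ (st-linˡ (toℕ i) y) x x′)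
                    (+-cong (sym (op-⊙ i _ _)) (sym (op-⊙ i _ _))))
        ; op-+ʳ = λ i x y y′ → trans (op-⊙ i _ _) (trans (IsLinear.f-+ (st-linʳ (toℕ i) x) y y′)
                    (+-cong (sym (op-⊙ i _ _)) (sym (op-⊙ i _ _))))
        ; op-*ˡ = λ i k x y → trans (op-⊙ i _ _) (trans (IsLinear.f-* (st-linˡ (toℕ i) y) k x)
                    (*ₗ-cong K-refl (sym (op-⊙ i _ _))))
        ; op-*ʳ = λ i k x y → trans (op-⊙ i _ _) (trans (IsLinear.f-* (st-linʳ (toℕ i) x) k y)
                    (*ₗ-cong K-refl (sym (op-⊙ i _ _))))
        ; dyck₁ = λ i j i<j x y z → begin
            op i x (op j y z)                   ≈⟨ trans (op-⊙ i _ _) (st-cong (toℕ i) refl (op-⊙ j y z)) ⟩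
            st (toℕ i) x (st (toℕ j) y z)       ≈⟨ st-st i<j x y z ⟩
            st (toℕ j) (st (toℕ i) x y) z       ≈⟨ trans (op-⊙ j _ _) (st-cong (toℕ j) (op-⊙ i x y) refl) ⟨
            op j (op i x y) z ∎
        ; dyck₂ = λ f x y z → dyck f x y z }
        where
        dyck : ∀ f x y z → sumFrom 0 (suc (toℕ f)) (λ j → op f x (opℕ j y z)) ≈
                           sumFrom (toℕ f) (suc l ∸ toℕ f) (λ k → op f (opℕ k x y) z)
        dyck f x y z = begin
          sumFrom 0 (suc i) (λ j → op f x (opℕ j y z))
            ≈⟨ sumFrom-cong 0 (suc i) (λ j _ _ → trans (op-⊙ f _ _)
                 (trans (st-cong i refl (opℕ-⊙ j y z)) (IsLinear.f-sub (st-linʳ i x) _ _))) ⟩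
          sumFrom 0 (suc i) (λ j → st i x (⊙ j y z) - st i x (⊙ (suc j) y z))
            ≈⟨ telescope 0 (suc i) (λ j → st i x (⊙ j y z)) ⟩
          st i x (⊙ 0 y z) - st i x (⊙ (suc i) y z)
            ≈⟨ st-assoc i x y z ⟩
          st i (⊙ i x y) z
            ≈⟨ st-cong i (tail-⊙ i x y) refl ⟨
          st i (tail i x y) z
            ≈⟨ additive-sumFrom (IsLinear.additive (st-linˡ i z)) i (suc l ∸ i) (λ k → opℕ k x y) ⟩
          sumFrom i (suc l ∸ i) (λ k → st i (opℕ k x y) z)
            ≈⟨ sumFrom-cong i (suc l ∸ i) (λ k _ _ → op-⊙ f (opℕ k x y) z) ⟨
          sumFrom i (suc l ∸ i) (λ k → op f (opℕ k x y) z) ∎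
          where i = toℕ f

  strOf : ∀ {a ℓa} {V : VSpace a ℓa} {l} → Ops V l → DyckStr K l a ℓa
  strOf {V = V} O = record
    { vecSpace = V ; op = λ i x y → ⊙ (toℕ i) x y - ⊙ (suc (toℕ i)) x y }
    where
    open VS V
    open Ops O

-- Linear extension from trees of bounded size

module TreeSize (𝕀 : Index) {a} (X : Set a) where
  open Index 𝕀
  open Trees 𝕀 X

  size : ∀ {b} → T b → ℕ
  size (leaf _)      = 1
  size (app _ _ u v) = size u ℕ.+ size v

  0<size : ∀ {b} (t : T b) → 0 < size t
  0<size (leaf _)      = s≤s z≤n
  0<size (app _ _ u v) = ℕₚ.≤-trans (0<size u) (ℕₚ.m≤m+n (size u) (size v))

  -- Homogeneity of the formal term, not of its class under `_≋_`. Every rewriting rule preserves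
  -- the number of leaves, so the terms produced by `mul` stay homogeneous.
  Sized : ℕ → FA → Set
  Sized n (gen t)    = size t ≡ n
  Sized n zer        = ⊤
  Sized n (plus x y) = Sized n x × Sized n y
  Sized n (inv x)    = Sized n x

  mapApp-sized : ∀ k u {p} d → Sized p d → Sized (size u ℕ.+ p) (mapApp k u d)
  mapApp-sized k u (gen t) e           = ≡.cong (size u ℕ.+_) e
  mapApp-sized k u zer _               = tt
  mapApp-sized k u (plus x y) (e , e′) = mapApp-sized k u x e , mapApp-sized k u y e′
  mapApp-sized k u (inv x) e           = mapApp-sized k u x e

  mul-sized : ∀ {b} k (t : T b) {p} d → Sized p d → Sized (size t ℕ.+ p) (mul k t d)
  mul-sized k (leaf x) d e = mapApp-sized k (leaf x) d e
  mul-sized k (app j _ u v) {p} d e with suc (ρ k) ≤? ρ j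
  ... | yes lt = mapApp-sized k (app j lt u v) d e
  ... | no _   = ≡.subst (λ n → Sized n (mul j u (mul k v d))) assoc (mul-sized j u _ (mul-sized k v d e))
               , ≡.subst (λ n → Sized n (mul k u (plus (mul o v d) (inv (mul k v d))))) assoc
                   (mul-sized k u _ (mul-sized o v d e , mul-sized k v d e))
    where
    assoc : size u ℕ.+ (size v ℕ.+ p) ≡ size u ℕ.+ size v ℕ.+ p
    assoc = ≡.sym (ℕₚ.+-assoc (size u) (size v) p)

  module _ {g ℓ} (G : AbelianGroup g ℓ) where
    open Ab G

    lift-sized : ∀ {f h} {p} → (∀ t → size t ≡ p → f t ≈ h t) → ∀ m → Sized p m → lift G f m ≈ lift G h m
    lift-sized e (gen t) s             = e t s
    lift-sized e zer _                 = refl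
    lift-sized e (plus x y) (s , s′)   = +-cong (lift-sized e x s) (lift-sized e y s′)
    lift-sized e (inv x) s             = -‿cong (lift-sized e x s)

    lift-zero : ∀ m → lift G (λ _ → 0#) m ≈ 0#
    lift-zero = additive-ext G (lift-additive G _) additive-0 (λ _ → refl)

module _ {c ℓ} (K : Field c ℓ) where
  open Linear K

  module HomTail {l a ℓa b ℓb} (A : DyckStr K l a ℓa) (B : DyckStr K l b ℓb) where
    private
      module A = DyckStr A
      module B = DyckStr B
      module AS = Str A
      module BS = Str B
      module VA = VS A.vecSpace
      module VB = VS B.vecSpace

    hom-linear : (h : Hom K A B) → IsLinear A.vecSpace B.vecSpace (Hom.fun h)
    hom-linear h = record
      { additive = record { f-cong = Hom.cong h ; f-+ = Hom.+-hom h } ; f-* = Hom.*ₗ-hom h }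

    hom-tail : (h : Hom K A B) → ∀ k x y → Hom.fun h (AS.tail k x y) VB.≈ BS.tail k (Hom.fun h x) (Hom.fun h y)
    hom-tail h k x y = sums k (suc l ∸ k)
      where
      module h = IsLinear (hom-linear h)
      opℕ-hom : ∀ j → Hom.fun h (A.opℕ j x y) VB.≈ B.opℕ j (Hom.fun h x) (Hom.fun h y)
      opℕ-hom j with j <? suc l
      ... | yes p = Hom.op-hom h _ x y
      ... | no _  = h.f-0
      sums : ∀ k n → Hom.fun h (A.sumFrom k n (λ j → A.opℕ j x y)) VB.≈
                     B.sumFrom k n (λ j → B.opℕ j (Hom.fun h x) (Hom.fun h y))
      sums k zero    = h.f-0
      sums k (suc n) = VB.trans (h.f-+ _ _) (VB.+-cong (opℕ-hom k) (sums (suc k) n))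

    tail-hom : ∀ {f} → IsLinear A.vecSpace B.vecSpace f →
               (∀ k x y → f (AS.tail k x y) VB.≈ BS.tail k (f x) (f y)) → Hom K A B
    tail-hom {f} F e = record
      { fun = f ; cong = f-cong ; +-hom = f-+ ; *ₗ-hom = f-*
      ; op-hom = λ i x y → begin
          f (A.op i x y)                                        ≈⟨ f-cong (VA.trans (VA.sym (AS.opℕ-toℕ i x y)) (AS.opℕ-tail (toℕ i) x y)) ⟩
          f (AS.tail (toℕ i) x y VA.- AS.tail (suc (toℕ i)) x y) ≈⟨ VB.trans (f-sub _ _) (VB.sub-cong (e (toℕ i) x y) (e (suc (toℕ i)) x y)) ⟩
          BS.tail (toℕ i) (f x) (f y) VB.- BS.tail (suc (toℕ i)) (f x) (f y)
            ≈⟨ VB.trans (VB.sym (BS.opℕ-toℕ i _ _)) (BS.opℕ-tail (toℕ i) _ _) ⟨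
          B.op i (f x) (f y) ∎ }
      where
      open IsLinear F
      open VB using (begin_; step-≈-⟩; step-≈-⟨; _∎)

  algOf : (𝕀 : Index) (φ : ℕ → ℕ) → φ 0 ≡ 0 → (∀ {i k} → i ≤ k → φ i ≤ φ k) →
          ∀ {a ℓa} {V : VSpace a ℓa} {m} → Ops V m → Alg 𝕀 a ℓa
  algOf 𝕀 φ φ0 mono {V = V} O = record
    { group = Module.+ᴹ-abelianGroup V
    ; op = λ i → ⊙ (φ (ρ i))
    ; op-cong = λ i → ⊙-cong (φ (ρ i))
    ; op-+ˡ = λ i x x′ y → IsLinear.f-+ (⊙-linˡ (φ (ρ i)) y) x x′
    ; op-+ʳ = λ i x y y′ → IsLinear.f-+ (⊙-linʳ (φ (ρ i)) x) y y′
    ; rel = λ {i} {k} i≤k x y z → ≡.subst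
        (λ w → ⊙ (φ (ρ k)) (⊙ (φ (ρ i)) x y) z ≈
               ⊙ (φ (ρ i)) x (⊙ (φ (ρ k)) y z) + ⊙ (φ (ρ k)) x (⊙ w y z - ⊙ (φ (ρ k)) y z))
        (≡.sym (≡.trans (≡.cong φ ρo) φ0)) (rel (mono i≤k) x y z) }
    where
    open Index 𝕀
    open Ops O
    open VS V

  module FreeDyck {m a ℓa} (D : DyckStr K m a ℓa) (isDyck : IsDyckAlgebra K D)
                  (X : Set a) (ι : X → DyckStr.Carrierᴹ D) (free : IsFree K D X ι) where

    V : VSpace a ℓa
    V = DyckStr.vecSpace D

    module V = VS V

    O : Ops V m
    O = Str.tailOps D isDyck

    module O = Ops O
    open O using (⊙) public

    record IsOpsHom {W : VSpace a ℓa} (P : Ops W m) (f : V.Carrier → Module.Carrierᴹ W) : Set (c ⊔ a ⊔ ℓa) where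
      no-eta-equality
      field
        linear : IsLinear V W f
        ⊙-hom  : ∀ k x y → Module._≈ᴹ_ W (f (⊙ k x y)) (Ops.⊙ P k (f x) (f y))
      open IsLinear linear public

    module _ {W : VSpace a ℓa} (P : Ops W m) where
      private
        module W = VS W
        S = strOf P
        isS : IsDyckAlgebra K S
        isS = Str.ops⇒isDyck S P (λ _ _ _ → W.refl)

      extend : (f : X → W.Carrier) → Σ (V.Carrier → W.Carrier) λ g → IsOpsHom P g × (∀ x → g (ι x) W.≈ f x)
      extend f with free S isS f
      ... | h , h-ι , _ = Hom.fun h , record
        { linear = HomTail.hom-linear D S h
        ; ⊙-hom = λ k x y → W.trans (HomTail.hom-tail D S h k x y) (Str.tail-⊙ S P (λ _ _ _ → W.refl) k _ _) } , h-ι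

      unique : ∀ {g h} → IsOpsHom P g → IsOpsHom P h → (∀ x → g (ι x) W.≈ h (ι x)) → ∀ d → g d W.≈ h d
      unique {g} {h} G H e d = W.trans (proj₂ (proj₂ u) (toHom G) e d) (W.sym (proj₂ (proj₂ u) (toHom H) (λ _ → W.refl) d))
        where
        u = free S isS (λ x → h (ι x))
        toHom : ∀ {g} → IsOpsHom P g → Hom K D S
        toHom G = HomTail.tail-hom D S (IsOpsHom.linear G) λ k x y →
          W.trans (IsOpsHom.⊙-hom G k x y) (W.sym (Str.tail-⊙ S P (λ _ _ _ → W.refl) k _ _))

    𝕀 : Index
    𝕀 = record { I = Fin (suc m) ; ρ = toℕ ; o = Fin.zero ; ρo = ≡.refl }

    open Trees 𝕀 X public
    open TreeSize 𝕀 X public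
    private
      I = Fin (suc m)

    DAlg : Alg 𝕀 a ℓa
    DAlg = algOf 𝕀 (λ k → k) ≡.refl (λ p → p) O

    opD : I → V.Carrier → V.Carrier → V.Carrier
    opD i = ⊙ (toℕ i)

    opD-linˡ : ∀ i y → IsLinear V V (λ x → opD i x y)
    opD-linˡ i = O.⊙-linˡ (toℕ i)

    opD-linʳ : ∀ i x → IsLinear V V (opD i x)
    opD-linʳ i = O.⊙-linʳ (toℕ i)

    evD : FA → V.Carrier
    evD = ev DAlg ι

    tr : ∀ {b} → T b → V.Carrier
    tr = evT DAlg ι

    module evD = IsHom (ev-isHom DAlg ι)

    tr-wk : ∀ {b} (t : T b) → tr (wk t) ≡ tr t
    tr-wk (leaf x)      = ≡.refl
    tr-wk (app _ _ _ _) = ≡.refl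

    -- g vanishes on all iterated products of n + 1 elements.
    Deg : (W : VSpace a ℓa) → ℕ → (V.Carrier → Module.Carrierᴹ W) → Set (a ⊔ ℓa)
    Deg W zero    g = ⊤ {a} × (∀ d → VS._≈_ W (g d) (VS.0# W))
    Deg W (suc n) g = ∀ (i : I) d → Deg W n (λ e → g (opD i d e)) × Deg W n (λ e → g (opD i e d))

    module _ {W : VSpace a ℓa} where
      private module W = VS W

      deg-resp : ∀ n {g h} → (∀ d → g d W.≈ h d) → Deg W n g → Deg W n h
      deg-resp zero    e (_ , z) = tt , λ d → W.trans (W.sym (e d)) (z d)
      deg-resp (suc n) e δ i d = deg-resp n (λ _ → e _) (proj₁ (δ i d)) , deg-resp n (λ _ → e _) (proj₂ (δ i d))

      deg-suc : ∀ n {g} → Deg W n g → Deg W (suc n) g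
      deg-suc zero    (_ , z) i d = (tt , λ _ → z _) , (tt , λ _ → z _)
      deg-suc (suc n) δ i d = deg-suc n (proj₁ (δ i d)) , deg-suc n (proj₂ (δ i d))

      deg-opʳ : ∀ n {g} → Deg W n g → ∀ i d → Deg W n (λ e → g (opD i d e))
      deg-opʳ n δ i d = proj₁ (deg-suc n δ i d)

      deg-opˡ : ∀ n {g} → Deg W n g → ∀ i d → Deg W n (λ e → g (opD i e d))
      deg-opˡ n δ i d = proj₂ (deg-suc n δ i d)

      deg-+ : ∀ n {g h} → Deg W n g → Deg W n h → Deg W n (λ d → g d W.+ h d)
      deg-+ zero (_ , z) (_ , z′) = tt , λ d → W.trans (W.+-cong (z d) (z′ d)) (W.+-identityˡ _)
      deg-+ (suc n) δ ε i d = deg-+ n (proj₁ (δ i d)) (proj₁ (ε i d)) , deg-+ n (proj₂ (δ i d)) (proj₂ (ε i d))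

      deg-sub : ∀ n {g h} → Deg W n g → Deg W n h → Deg W n (λ d → g d W.- h d)
      deg-sub zero (_ , z) (_ , z′) = tt , λ d → W.trans (W.sub-cong (z d) (z′ d)) (W.-‿inverseʳ W.0#)
      deg-sub (suc n) δ ε i d = deg-sub n (proj₁ (δ i d)) (proj₁ (ε i d)) , deg-sub n (proj₂ (δ i d)) (proj₂ (ε i d))

      deg-∘ : ∀ {W′ : VSpace a ℓa} n {f g} → IsLinear W W′ f → Deg W n g → Deg W′ n (λ d → f (g d))
      deg-∘ {W′} zero F (_ , z) = tt , λ d → VS.trans W′ (IsLinear.f-cong F (z d)) (IsLinear.f-0 F)
      deg-∘ {W′} (suc n) F δ i d = deg-∘ {W′} n F (proj₁ (δ i d)) , deg-∘ {W′} n F (proj₂ (δ i d))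

    zeroOps : (W : VSpace a ℓa) → Ops W m
    zeroOps W = record
      { ⊙ = λ _ _ _ → W.0# ; bilinear = λ _ → record { linˡ = λ _ → linear-0 ; linʳ = λ _ → linear-0 }
      ; vanish = λ _ _ _ → W.refl ; rel = λ _ _ _ _ → W.sym (W.+-identityˡ _) }
      where module W = VS W

    ⊙-fin : ∀ {k} (p : k ≤ m) → toℕ (fromℕ< (s≤s p)) ≡ k
    ⊙-fin p = Finₚ.toℕ-fromℕ< (s≤s p)

    evD-⊙ : ∀ i (t t′ : T 0) → opD i (tr t) (tr t′) V.≈ evD (gen t ⊙⟨ i ⟩ gen t′)
    evD-⊙ i t t′ = V.sym (evD.hom i (gen t) (gen t′))

    module _ {W : VSpace a ℓa} where
      private module W = VS W

      -- At this stage trees are not yet known to span D. A linear map that kills all products is a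
      -- homomorphism to `zeroOps W`, so uniqueness in the universal property applies once it also
      -- kills the generators. That g kills x ⊙ᵢ y follows by using the induction hypothesis in y
      -- and then in x, since a product of two trees is a sum of trees.
      deg-trees-0 : ∀ n {g} → IsLinear V W g → Deg W n g → (∀ t → g (tr {0} t) W.≈ W.0#) → ∀ d → g d W.≈ W.0#
      deg-trees-0 zero    G (_ , z) e d = z d
      deg-trees-0 (suc n) {g} G δ e d = unique (zeroOps W)
        (record { linear = G ; ⊙-hom = products })
        (record { linear = linear-0 ; ⊙-hom = λ _ _ _ → W.refl }) (λ x → e (leaf x)) d
        where
        module G = IsLinear G
        on-FA : ∀ x → g (evD x) W.≈ W.0#
        on-FA = additive-ext (Module.+ᴹ-abelianGroup W) (additive-∘ G.additive evD.additive)
          additive-0 e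
        productsFin : ∀ i x y → g (opD i x y) W.≈ W.0#
        productsFin i x = deg-trees-0 n (linear-∘ G (opD-linʳ i x)) (proj₁ (δ i x)) λ t →
          deg-trees-0 n (linear-∘ G (opD-linˡ i (tr t))) (proj₂ (δ i (tr t)))
            (λ t′ → W.trans (G.f-cong (evD-⊙ i t′ t)) (on-FA (gen t′ ⊙⟨ i ⟩ gen t))) x
        products : ∀ k x y → g (⊙ k x y) W.≈ W.0#
        products k x y = go (ℕₚ.≤-<-connex k m)
          where
          go : k ≤ m ⊎ m < k → g (⊙ k x y) W.≈ W.0#
          go (inj₁ p) = ≡.subst (λ k → g (⊙ k x y) W.≈ W.0#) (⊙-fin p) (productsFin (fromℕ< (s≤s p)) x y)
          go (inj₂ p) = W.trans (G.f-cong (O.vanish p x y)) G.f-0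

      deg-trees-≈ : ∀ n {g h} → IsLinear V W g → IsLinear V W h → Deg W n g → Deg W n h →
                    (∀ t → g (tr {0} t) W.≈ h (tr t)) → ∀ d → g d W.≈ h d
      deg-trees-≈ n G H δ ε e d = W.≈-from-0 (deg-trees-0 n (linear-sub G H) (deg-sub n δ ε)
        (λ t → W.trans (W.sub-cong (e t) W.refl) (W.-‿inverseʳ _)) d)

      -- Induction on k absorbs factors into the first argument; at k = 0, `deg-trees-0` in the
      -- second argument passes from trees to all of D.
      deg-first : ∀ k n {γ : V.Carrier → V.Carrier → W.Carrier} → (∀ d → IsLinear V W (γ d)) → (∀ d → Deg W n (γ d)) →
                  (∀ t → Deg W k (λ e → γ e (tr {0} t))) → ∀ d → Deg W k (λ e → γ e d)
      deg-first zero    n L δ ε d = tt , λ e → deg-trees-0 n (L e) (δ e) (λ t → proj₂ (ε t) e) d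
      deg-first (suc k) n L δ ε d i e =
        deg-first k n (λ f → L (opD i e f)) (λ f → δ (opD i e f)) (λ t → proj₁ (ε t i e)) d ,
        deg-first k n (λ f → L (opD i f e)) (λ f → δ (opD i f e)) (λ t → proj₂ (ε t i e)) d

    record Extension (W : VSpace a ℓa) (n : ℕ) (φ : T 0 → Module.Carrierᴹ W) : Set (c ⊔ a ⊔ ℓa) where
      no-eta-equality
      private module W = VS W
      field
        fun    : V.Carrier → W.Carrier
        linear : IsLinear V W fun
        degree : Deg W n fun
        on-tr  : ∀ t → fun (tr t) W.≈ φ t

    -- The inductive step: a square-zero extension of D by W

    module Cocycle {n : ℕ} {W : VSpace a ℓa}
      (extension : (φ : T 0 → Module.Carrierᴹ W) → (∀ t → n < size t → VS._≈_ W (φ t) (VS.0# W)) → Extension W n φ)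
      (φ : T 0 → Module.Carrierᴹ W) (φ-supp : ∀ t → suc n < size t → VS._≈_ W (φ t) (VS.0# W)) where
      private
        module W = VS W
        Wg = Module.+ᴹ-abelianGroup W

      φ̂ : FA → W.Carrier
      φ̂ = lift Wg φ

      φ̂-additive : Additive FAgroup Wg φ̂
      φ̂-additive = lift-additive Wg φ

      φ̂-supp : ∀ i (t t′ : T 0) → suc n < size t ℕ.+ size t′ → φ̂ (mul i t (gen t′)) W.≈ W.0#
      φ̂-supp i t t′ big = W.trans
        (lift-sized Wg (λ s e → φ-supp s (≡.subst (suc n <_) (≡.sym e) big)) (mul i t (gen t′))
          (mul-sized i t (gen t′) ≡.refl))
        (lift-zero Wg (mul i t (gen t′)))

      -- A tree `t′` has at least one leaf, so as a function of t the support shrinks from size ≤ n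
      -- + 1 to size ≤ n.
      left : ∀ i (t′ : T 0) → Extension W n (λ t → φ̂ (mul i t (gen t′)))
      left i t′ = extension _ λ t p → φ̂-supp i t t′
        (≡.subst (_≤ size t ℕ.+ size t′) (ℕₚ.+-comm (suc n) 1) (ℕₚ.+-mono-≤ p (0<size t′)))

      module left i t′ = Extension (left i t′)

      -- If `t′` has more than n leaves, every product t ⊙ᵢ t′ has more than n + 1; then
      -- `left.fun i t′` vanishes on trees and, being of degree n, on all of D.
      right : ∀ i d → Extension W n (λ t′ → left.fun i t′ d)
      right i d = extension _ λ t′ p → deg-trees-0 n (left.linear i t′) (left.degree i t′)
        (λ t → W.trans (left.on-tr i t′ t) (φ̂-supp i t t′ (ℕₚ.+-mono-≤ (0<size t) p))) d

      module right i d = Extension (right i d)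

      β : I → V.Carrier → V.Carrier → W.Carrier
      β = right.fun

      β-linʳ : ∀ i d → IsLinear V W (β i d)
      β-linʳ = right.linear

      β-degʳ : ∀ i d → Deg W n (β i d)
      β-degʳ = right.degree

      β-degˡ : ∀ i d → Deg W n (λ e → β i e d)
      β-degˡ i = deg-first n n (β-linʳ i) (β-degʳ i)
        (λ t → deg-resp n (λ d → W.sym (right.on-tr i d t)) (left.degree i t))

      private
        β-≈ : ∀ i {d} {f : V.Carrier → W.Carrier} → IsLinear V W f → Deg W n f →
              (∀ t′ → left.fun i t′ d W.≈ f (tr t′)) → ∀ e → β i d e W.≈ f e
        β-≈ i {d} F δ e = deg-trees-≈ n (β-linʳ i d) F (β-degʳ i d) δ (λ t′ → W.trans (right.on-tr i d t′) (e t′))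

      β-linˡ : ∀ i e → IsLinear V W (λ d → β i d e)
      β-linˡ i e = record
        { additive = record
          { f-cong = λ {d} {d′} p → β-≈ i (β-linʳ i d′) (β-degʳ i d′)
              (λ t′ → W.trans (IsLinear.f-cong (left.linear i t′) p) (W.sym (right.on-tr i d′ t′))) e
          ; f-+ = λ d d′ → β-≈ i (linear-+ (β-linʳ i d) (β-linʳ i d′)) (deg-+ n (β-degʳ i d) (β-degʳ i d′))
              (λ t′ → W.trans (IsLinear.f-+ (left.linear i t′) d d′)
                 (W.sym (W.+-cong (right.on-tr i d t′) (right.on-tr i d′ t′)))) e }
        ; f-* = λ k d → β-≈ i (linear-* k (β-linʳ i d)) (deg-∘ n (linear-* k linear-id) (β-degʳ i d))
              (λ t′ → W.trans (IsLinear.f-* (left.linear i t′) k d)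
                 (W.sym (W.*ₗ-cong W.K-refl (right.on-tr i d t′)))) e }

      β-cong : ∀ i {x x′ y y′} → x V.≈ x′ → y V.≈ y′ → β i x y W.≈ β i x′ y′
      β-cong i {y = y} p q = W.trans (IsLinear.f-cong (β-linˡ i y) p) (IsLinear.f-cong (β-linʳ i _) q)

      β-ev : ∀ i x y → β i (evD x) (evD y) W.≈ φ̂ (x ⊙⟨ i ⟩ y)
      β-ev i x y = additive-ext Wg
        (additive-∘ (IsLinear.additive (β-linˡ i (evD y))) evD.additive)
        (additive-∘ φ̂-additive (⊙-additiveˡ i y))
        (λ t → additive-ext Wg
          (additive-∘ (IsLinear.additive (β-linʳ i (tr t))) evD.additive)
          (additive-∘ φ̂-additive (⊙-additiveʳ i (gen t)))
          (λ t′ → W.trans (right.on-tr i (tr t) t′) (left.on-tr i t′ t)) y) x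

      private
        o : I
        o = Fin.zero
        module M = Alg treeAlg
        module A = Alg DAlg

      -- The cocycle condition. On sums of trees it is the relation of `treeAlg` under `φ̂`. The
      -- arguments x, y, z are then freed one at a time, which works because both sides have degree
      -- n in each of them.
      β-rel : ∀ {i k : I} → toℕ i ≤ toℕ k → ∀ x y z →
              β k (opD i x y) z W.≈ β i x (opD k y z) W.+ β k x (A.co k y z)
      β-rel {i} {k} i≤k x y z = in-z z
        where
        co-linˡ : ∀ z → IsLinear V V (λ y → A.co k y z)
        co-linˡ z = linear-sub (opD-linˡ o z) (opD-linˡ k z)
        co-linʳ : ∀ y → IsLinear V V (A.co k y)
        co-linʳ y = linear-sub (opD-linʳ o y) (opD-linʳ k y)
        co-degʳ : ∀ {g} → IsLinear V W g → Deg W n g → ∀ y → Deg W n (λ z → g (A.co k y z))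
        co-degʳ G δ y = deg-resp n (λ z → W.sym (IsLinear.f-sub G _ _)) (deg-sub n (deg-opʳ n δ o y) (deg-opʳ n δ k y))
        co-degˡ : ∀ {g} → IsLinear V W g → Deg W n g → ∀ z → Deg W n (λ y → g (A.co k y z))
        co-degˡ G δ z = deg-resp n (λ y → W.sym (IsLinear.f-sub G _ _)) (deg-sub n (deg-opˡ n δ o z) (deg-opˡ n δ k z))
        Claim : V.Carrier → V.Carrier → V.Carrier → Set ℓa
        Claim x y z = β k (opD i x y) z W.≈ β i x (opD k y z) W.+ β k x (A.co k y z)
        on-FA : ∀ p q r → Claim (evD p) (evD q) (evD r)
        on-FA p q r = begin
          β k (opD i (evD p) (evD q)) (evD r)   ≈⟨ β-cong k (V.sym (evD.hom i p q)) V.refl ⟩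
          β k (evD (p ⊙⟨ i ⟩ q)) (evD r)         ≈⟨ β-ev k (p ⊙⟨ i ⟩ q) r ⟩
          φ̂ (p ⊙⟨ i ⟩ q ⊙⟨ k ⟩ r)                ≈⟨ Additive.f-cong φ̂-additive (M.rel i≤k p q r) ⟩
          φ̂ (p ⊙⟨ i ⟩ (q ⊙⟨ k ⟩ r)) W.+ φ̂ (p ⊙⟨ k ⟩ M.co k q r)
            ≈⟨ W.+-cong (β-ev i p (q ⊙⟨ k ⟩ r)) (β-ev k p (M.co k q r)) ⟨
          β i (evD p) (evD (q ⊙⟨ k ⟩ r)) W.+ β k (evD p) (evD (M.co k q r))
            ≈⟨ W.+-cong (β-cong i V.refl (evD.hom k q r))
                        (β-cong k V.refl (V.trans (evD.f-sub (q ⊙⟨ o ⟩ r) (q ⊙⟨ k ⟩ r)) (V.sub-cong (evD.hom o q r) (evD.hom k q r)))) ⟩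
          _ ∎
          where open VS W using (begin_; step-≈-⟩; step-≈-⟨; _∎)
        in-x : ∀ t₂ t₃ x → Claim x (tr {0} t₂) (tr {0} t₃)
        in-x t₂ t₃ = deg-trees-≈ n
          (linear-∘ (β-linˡ k (tr t₃)) (opD-linˡ i (tr t₂)))
          (linear-+ (β-linˡ i (opD k (tr t₂) (tr t₃))) (β-linˡ k (A.co k (tr t₂) (tr t₃))))
          (deg-opˡ n (β-degˡ k (tr t₃)) i (tr t₂))
          (deg-+ n (β-degˡ i (opD k (tr t₂) (tr t₃))) (β-degˡ k (A.co k (tr t₂) (tr t₃))))
          (λ t₁ → on-FA (gen t₁) (gen t₂) (gen t₃))
        in-y : ∀ t₃ y → Claim x y (tr {0} t₃)
        in-y t₃ = deg-trees-≈ n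
          (linear-∘ (β-linˡ k (tr t₃)) (opD-linʳ i x))
          (linear-+ (linear-∘ (β-linʳ i x) (opD-linˡ k (tr t₃))) (linear-∘ (β-linʳ k x) (co-linˡ (tr t₃))))
          (deg-opʳ n (β-degˡ k (tr t₃)) i x)
          (deg-+ n (deg-opˡ n (β-degʳ i x) k (tr t₃)) (co-degˡ (β-linʳ k x) (β-degʳ k x) (tr t₃)))
          (λ t₂ → in-x t₂ t₃ x)
        in-z : ∀ z → Claim x y z
        in-z = deg-trees-≈ n
          (β-linʳ k (opD i x y))
          (linear-+ (linear-∘ (β-linʳ i x) (opD-linʳ k y)) (linear-∘ (β-linʳ k x) (co-linʳ y)))
          (β-degʳ k (opD i x y))
          (deg-+ n (deg-opʳ n (β-degʳ i x) k y) (co-degʳ (β-linʳ k x) (β-degʳ k x) y))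
          (λ t₃ → in-y t₃ y)

      βℕ : ℕ → V.Carrier → V.Carrier → W.Carrier
      βℕ k x y with k <? suc m
      ... | yes p = β (fromℕ< p) x y
      ... | no _  = W.0#

      βℕ-toℕ : ∀ i x y → βℕ (toℕ i) x y W.≈ β i x y
      βℕ-toℕ i x y with toℕ i <? suc m
      ... | yes p = W.reflexive (≡.cong (λ j → β j x y) (Finₚ.fromℕ<-toℕ i p))
      ... | no ¬p = ⊥-elim (¬p (Finₚ.toℕ<n i))

      βℕ-big : ∀ {k} → m < k → ∀ x y → βℕ k x y W.≈ W.0#
      βℕ-big {k} p x y with k <? suc m
      ... | yes q = ⊥-elim (ℕₚ.<⇒≱ p (ℕₚ.≤-pred q))
      ... | no _  = W.refl

      βℕ-bilinear : ∀ k → IsBilinear V W (βℕ k)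
      βℕ-bilinear k with k <? suc m
      ... | yes p = record { linˡ = β-linˡ (fromℕ< p) ; linʳ = β-linʳ (fromℕ< p) }
      ... | no _  = record { linˡ = λ _ → linear-0 ; linʳ = λ _ → linear-0 }

      module _ (k : ℕ) where
        open IsBilinear (βℕ-bilinear k) public using () renaming (linˡ to βℕ-linˡ; linʳ to βℕ-linʳ; β-cong to βℕ-cong)

      βℕ-rel : ∀ {i k} → i ≤ k → ∀ x y z →
               βℕ k (⊙ i x y) z W.≈ βℕ i x (⊙ k y z) W.+ βℕ k x (⊙ 0 y z V.- ⊙ k y z)
      βℕ-rel {i} {k} i≤k x y z = go (ℕₚ.≤-<-connex k m)
        where
        Claim : ℕ → ℕ → Set ℓa
        Claim i k = βℕ k (⊙ i x y) z W.≈ βℕ i x (⊙ k y z) W.+ βℕ k x (⊙ 0 y z V.- ⊙ k y z)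
        fin : ∀ {k} → k ≤ m → I
        fin p = fromℕ< (s≤s p)
        go : k ≤ m ⊎ m < k → Claim i k
        go (inj₂ p) = W.trans (βℕ-big p _ z)
          (W.sym (W.trans (W.+-cong (W.trans (βℕ-cong i V.refl (O.vanish p y z)) (IsLinear.f-0 (βℕ-linʳ i x)))
                                    (βℕ-big p x _)) (W.+-identityˡ _)))
        go (inj₁ p) = ≡.subst₂ Claim (⊙-fin q) (⊙-fin p)
          (W.trans (βℕ-toℕ (fin p) _ z)
            (W.trans (β-rel {fin q} {fin p} (≡.subst₂ _≤_ (≡.sym (⊙-fin q)) (≡.sym (⊙-fin p)) i≤k) x y z)
              (W.sym (W.+-cong (βℕ-toℕ (fin q) x _) (βℕ-toℕ (fin p) x _)))))
          where
          q : i ≤ m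
          q = ℕₚ.≤-trans i≤k p

      C : VSpace a ℓa
      C = MDP.⟨module⟩ V W

      private
        linear-pair : ∀ {U : VSpace a ℓa} {f g} → IsLinear U V f → IsLinear U W g → IsLinear U C (λ u → f u , g u)
        linear-pair F G = record
          { additive = record
            { f-cong = λ p → IsLinear.f-cong F p , IsLinear.f-cong G p
            ; f-+ = λ x y → IsLinear.f-+ F x y , IsLinear.f-+ G x y }
          ; f-* = λ k x → IsLinear.f-* F k x , IsLinear.f-* G k x }

        linear-proj₁ : IsLinear C V proj₁
        linear-proj₁ = record
          { additive = record { f-cong = proj₁ ; f-+ = λ _ _ → V.refl } ; f-* = λ _ _ → V.refl }

        linear-proj₂ : IsLinear C W proj₂
        linear-proj₂ = record
          { additive = record { f-cong = proj₂ ; f-+ = λ _ _ → W.refl } ; f-* = λ _ _ → W.refl }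

      -- The W-entries of the factors do not enter a product, so W is an ideal annihilated by
      -- everything, and the relations amount to those of D together with `βℕ-rel`.
      COps : Ops C m
      COps = record
        { ⊙ = λ k x y → ⊙ k (proj₁ x) (proj₁ y) , βℕ k (proj₁ x) (proj₁ y)
        ; bilinear = λ k → record
          { linˡ = λ y → linear-pair (linear-∘ (O.⊙-linˡ k (proj₁ y)) linear-proj₁)
                                      (linear-∘ (βℕ-linˡ k (proj₁ y)) linear-proj₁)
          ; linʳ = λ x → linear-pair (linear-∘ (O.⊙-linʳ k (proj₁ x)) linear-proj₁)
                                      (linear-∘ (βℕ-linʳ k (proj₁ x)) linear-proj₁) }
        ; vanish = λ p x y → O.vanish p _ _ , βℕ-big p _ _
        ; rel = λ p x y z → O.rel p _ _ _ , βℕ-rel p _ _ _ }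

      private
        h-ext = extend COps (λ x → ι x , φ (leaf x))
        h : V.Carrier → Module.Carrierᴹ C
        h = proj₁ h-ext
        module h = IsOpsHom (proj₁ (proj₂ h-ext))

        h₁ : ∀ d → proj₁ (h d) V.≈ d
        h₁ = unique O
          (record { linear = linear-∘ linear-proj₁ h.linear ; ⊙-hom = λ k x y → proj₁ (h.⊙-hom k x y) })
          (record { linear = linear-id ; ⊙-hom = λ _ _ _ → V.refl })
          (λ x → proj₁ (proj₂ (proj₂ h-ext) x))

        g : V.Carrier → W.Carrier
        g d = proj₂ (h d)

        g-op : ∀ i x y → g (opD i x y) W.≈ β i x y
        g-op i x y = W.trans (proj₂ (h.⊙-hom (toℕ i) x y)) (W.trans (βℕ-toℕ i _ _) (β-cong i (h₁ x) (h₁ y)))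

        g-tr : ∀ {b} (t : T b) → g (tr t) W.≈ φ (wk t)
        g-tr (leaf x)      = proj₂ (proj₂ (proj₂ h-ext) x)
        g-tr (app j _ u v) = begin
          g (opD j (tr u) (tr v))              ≈⟨ g-op j _ _ ⟩
          β j (tr u) (tr v)                    ≡⟨ ≡.cong (λ w → β j w (tr v)) (tr-wk u) ⟨
          β j (tr (wk u)) (tr v)               ≈⟨ β-ev j (gen (wk u)) (gen v) ⟩
          φ̂ (gen (wk u) ⊙⟨ j ⟩ gen v)          ≡⟨ ≡.cong φ̂ (gen-app j u v) ⟩
          φ (app j z≤n u v) ∎
          where open VS W using (begin_; step-≈-⟩; step-≈-⟨; step-≡-⟩; step-≡-⟨; _∎)

      -- The degree rises by one because `g` of a product is a value of β, which has degree n in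
      -- either argument.
      next : Extension W (suc n) φ
      next = record
        { fun = g
        ; linear = linear-∘ linear-proj₂ h.linear
        ; degree = λ i d → deg-resp n (λ e → W.sym (g-op i d e)) (β-degʳ i d)
                         , deg-resp n (λ e → W.sym (g-op i e d)) (β-degˡ i d)
        ; on-tr = λ t → W.trans (g-tr t) (W.reflexive (≡.cong φ (wk-id t))) }

    extension : ∀ n (W : VSpace a ℓa) (φ : T 0 → Module.Carrierᴹ W) →
                (∀ t → n < size t → VS._≈_ W (φ t) (VS.0# W)) → Extension W n φ
    extension zero    W φ supp = record
      { fun = λ _ → VS.0# W ; linear = linear-0 ; degree = tt , λ _ → VS.refl W
      ; on-tr = λ t → VS.sym W (supp t (0<size t)) }
    extension (suc n) W φ supp = Cocycle.next {n} {W} (extension n W) φ supp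

-- Trees are a basis

module _ {c ℓ} (K : Field c ℓ) where
  open Linear K

  module Limit {m a ℓa} (D : DyckStr K m a ℓa) (isDyck : IsDyckAlgebra K D)
               (X : Set a) (ι : X → DyckStr.Carrierᴹ D) (free : IsFree K D X ι) where
    open FreeDyck K D isDyck X ι free

    module _ (W : VSpace a ℓa) (φ : T 0 → Module.Carrierᴹ W) where
      private module W = VS W

      trunc : ℕ → T 0 → W.Carrier
      trunc n t with size t ≤? n
      ... | yes _ = φ t
      ... | no _  = W.0#

      trunc-≤ : ∀ {n} t → size t ≤ n → trunc n t W.≈ φ t
      trunc-≤ {n} t p with size t ≤? n
      ... | yes _ = W.refl
      ... | no ¬p = ⊥-elim (¬p p)

      trunc-> : ∀ {n} t → n < size t → trunc n t W.≈ W.0#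
      trunc-> {n} t p with size t ≤? n
      ... | yes q = ⊥-elim (ℕₚ.<⇒≱ p q)
      ... | no _  = W.refl

      abstract
        stage : ∀ n → Extension W n (trunc n)
        stage n = extension n W (trunc n) (trunc-> {n})

      module stage n = Extension (stage n)

      stage-≤ : ∀ n t → size t ≤ n → stage.fun n (tr t) W.≈ φ t
      stage-≤ n t p = W.trans (stage.on-tr n t) (trunc-≤ t p)

      stage-> : ∀ n t → n < size t → stage.fun n (tr t) W.≈ W.0#
      stage-> n t p = W.trans (stage.on-tr n t) (trunc-> t p)

    module p = stage V (tr {0})

    -- The projection that fixes trees of size ≤ n and kills the larger ones.
    p : ℕ → V.Carrier → V.Carrier
    p = p.fun

    module _ {W : VSpace a ℓa} where
      private module W = VS W

      p-degree : ∀ n {f} → IsLinear V W f → Deg W n (λ d → f (p n d))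
      p-degree n F = deg-∘ {V} {W} n F (p.degree n)

      agree-below : ∀ n {f h} → IsLinear V W f → IsLinear V W h → Deg W n h →
                    (∀ t → size t ≤ n → f (tr t) W.≈ h (tr t)) → (∀ t → n < size t → h (tr {0} t) W.≈ W.0#) →
                    ∀ d → f (p n d) W.≈ h d
      agree-below n {f} {h} F H δ below above = deg-trees-≈ n (linear-∘ F (p.linear n)) H (p-degree n F) δ on-tree
        where
        on-tree : ∀ t → f (p n (tr t)) W.≈ h (tr t)
        on-tree t with ℕₚ.≤-<-connex (size t) n
        ... | inj₁ q = W.trans (IsLinear.f-cong F (stage-≤ V tr n t q)) (below t q)
        ... | inj₂ q = W.trans (IsLinear.f-cong F (stage-> V tr n t q)) (W.trans (IsLinear.f-0 F) (W.sym (above t q)))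

    p-absorb : ∀ {n n′} → n ≤ n′ → ∀ d → p n′ (p n d) V.≈ p n d
    p-absorb {n} {n′} n≤n′ = agree-below n (p.linear n′) (p.linear n) (p.degree n)
      (λ t q → V.trans (stage-≤ V tr n′ t (ℕₚ.≤-trans q n≤n′)) (V.sym (stage-≤ V tr n t q)))
      (stage-> V tr n)

    p-sized : ∀ {n q} x → Sized q x → q ≤ n → p n (evD x) V.≈ evD x
    p-sized {n} (gen t) ≡.refl q≤n   = stage-≤ V tr n t q≤n
    p-sized {n} zer _ _              = IsLinear.f-0 (p.linear n)
    p-sized {n} (plus x y) (e , e′) r = V.trans (IsLinear.f-+ (p.linear n) (evD x) (evD y)) (V.+-cong (p-sized x e r) (p-sized y e′ r))
    p-sized {n} (inv x) e r          = V.trans (IsLinear.f-neg (p.linear n) (evD x)) (V.-‿cong (p-sized x e r))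

    -- The inner projections give both sides finite degree in d and in d′, so trees suffice. There a
    -- factor that is too large gives zero, and otherwise the product is homogeneous of size at most
    -- n + n′.
    p-op : ∀ n n′ i d d′ → p (n ℕ.+ n′) (opD i (p n d) (p n′ d′)) V.≈ opD i (p n d) (p n′ d′)
    p-op n n′ i d d′ = deg-trees-≈ n
      (linear-∘ (p.linear N) (linear-∘ (opD-linˡ i (p n′ d′)) (p.linear n)))
      (linear-∘ (opD-linˡ i (p n′ d′)) (p.linear n))
      (p-degree n (linear-∘ (p.linear N) (opD-linˡ i (p n′ d′))))
      (p-degree n (opD-linˡ i (p n′ d′)))
      (λ t → outer t d′) d
      where
      N = n ℕ.+ n′
      Good : V.Carrier → Set ℓa
      Good x = p N x V.≈ x
      good-resp : ∀ {x y} → x V.≈ y → Good y → Good x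
      good-resp e g = V.trans (IsLinear.f-cong (p.linear N) e) (V.trans g (V.sym e))
      good-0 : Good V.0#
      good-0 = IsLinear.f-0 (p.linear N)
      inner : ∀ t t′ → size t ≤ n → Good (opD i (tr t) (p n′ (tr t′)))
      inner t t′ q with ℕₚ.≤-<-connex (size t′) n′
      ... | inj₂ r = good-resp (V.trans (IsLinear.f-cong (opD-linʳ i _) (stage-> V tr n′ t′ r)) (IsLinear.f-0 (opD-linʳ i _))) good-0
      ... | inj₁ r = good-resp (V.trans (IsLinear.f-cong (opD-linʳ i _) (stage-≤ V tr n′ t′ r)) (evD-⊙ i t t′))
                       (p-sized (mul i t (gen t′)) (mul-sized i t (gen t′) ≡.refl) (ℕₚ.+-mono-≤ q r))
      outer : ∀ t d′ → Good (opD i (p n (tr t)) (p n′ d′))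
      outer t d′ with ℕₚ.≤-<-connex (size t) n
      ... | inj₂ q = good-resp (V.trans (IsLinear.f-cong (opD-linˡ i _) (stage-> V tr n t q)) (IsLinear.f-0 (opD-linˡ i _))) good-0
      ... | inj₁ q = good-resp (IsLinear.f-cong (opD-linˡ i _) (stage-≤ V tr n t q))
        (deg-trees-≈ n′
          (linear-∘ (p.linear N) (linear-∘ (opD-linʳ i (tr t)) (p.linear n′)))
          (linear-∘ (opD-linʳ i (tr t)) (p.linear n′))
          (p-degree n′ (linear-∘ (p.linear N) (opD-linʳ i (tr t))))
          (p-degree n′ (opD-linʳ i (tr t)))
          (λ t′ → inner t t′ q) d′)

    p-⊙ : ∀ n n′ k d d′ → p (n ℕ.+ n′) (⊙ k (p n d) (p n′ d′)) V.≈ ⊙ k (p n d) (p n′ d′)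
    p-⊙ n n′ k d d′ with ℕₚ.≤-<-connex k m
    ... | inj₁ q = ≡.subst (λ k → p (n ℕ.+ n′) (⊙ k (p n d) (p n′ d′)) V.≈ ⊙ k (p n d) (p n′ d′)) (⊙-fin q)
                     (p-op n n′ (fromℕ< (s≤s q)) d d′)
    ... | inj₂ q = V.trans (IsLinear.f-cong (p.linear (n ℕ.+ n′)) (O.vanish q _ _))
                     (V.trans (IsLinear.f-0 (p.linear (n ℕ.+ n′))) (V.sym (O.vanish q _ _)))

    -- The algebra of elements carrying a degree bound

    private
      ⟦_⟧ : ℕ × V.Carrier → V.Carrier
      ⟦ n , d ⟧ = p n d

      module VM = Module V
      module CR = Field K

      -- (n , d) stands for p n d, so that elements carry a bound for their degree; a subtype of D
      -- would not fit at the levels of D.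
      bounded-raw : RawModule CR.Carrier a ℓa
      bounded-raw = record
        { Carrierᴹ = ℕ × V.Carrier
        ; _≈ᴹ_ = λ x y → ⟦ x ⟧ V.≈ ⟦ y ⟧
        ; _+ᴹ_ = λ x y → proj₁ x ℕ.⊔ proj₁ y , ⟦ x ⟧ V.+ ⟦ y ⟧
        ; _*ₗ_ = λ k x → proj₁ x , k VM.*ₗ proj₂ x
        ; _*ᵣ_ = λ x k → proj₁ x , proj₂ x VM.*ᵣ k
        ; 0ᴹ = 0 , V.0#
        ; -ᴹ_ = λ x → proj₁ x , V.- proj₂ x }

      module Bd = RawModule bounded-raw

      ⟦+⟧ : ∀ x y → ⟦ x Bd.+ᴹ y ⟧ V.≈ ⟦ x ⟧ V.+ ⟦ y ⟧
      ⟦+⟧ (n , d) (n′ , d′) = V.trans (IsLinear.f-+ (p.linear (n ℕ.⊔ n′)) (p n d) (p n′ d′))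
        (V.+-cong (p-absorb (ℕₚ.m≤m⊔n n n′) d) (p-absorb (ℕₚ.m≤n⊔m n n′) d′))

      ⟦*ᵣ⟧ : ∀ k x → ⟦ x Bd.*ᵣ k ⟧ V.≈ ⟦ x ⟧ VM.*ᵣ k
      ⟦*ᵣ⟧ k (n , d) = V.trans (IsLinear.f-cong (p.linear n) (V.sym (VM.*ₗ-*ᵣ-coincident k d)))
        (V.trans (IsLinear.f-* (p.linear n) k d) (VM.*ₗ-*ᵣ-coincident k _))

      mono : IsModuleMonomorphism bounded-raw VM.rawModule ⟦_⟧
      mono = record
        { isModuleHomomorphism = record
          { isBimoduleHomomorphism = record
            { +ᴹ-isGroupHomomorphism = record
              { isMonoidHomomorphism = record
                { isMagmaHomomorphism = record
                  { isRelHomomorphism = record { cong = λ e → e }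
                  ; homo = ⟦+⟧ }
                ; ε-homo = IsLinear.f-0 (p.linear 0) }
              ; ⁻¹-homo = λ x → IsLinear.f-neg (p.linear (proj₁ x)) (proj₂ x) }
            ; *ₗ-homo = λ k x → IsLinear.f-* (p.linear (proj₁ x)) k (proj₂ x)
            ; *ᵣ-homo = ⟦*ᵣ⟧ } }
        ; injective = λ e → e }

      bounded : VSpace a ℓa
      bounded = record { isModule = ModuleMonomorphism.isModule mono CR.isCommutativeRing VM.isModule }

      ⟦⟧-linear : IsLinear bounded V ⟦_⟧
      ⟦⟧-linear = record
        { additive = record { f-cong = λ e → e ; f-+ = ⟦+⟧ }
        ; f-* = λ k x → IsLinear.f-* (p.linear (proj₁ x)) k (proj₂ x) }

      ⟦⟧-reflect : ∀ {f} → IsLinear bounded V (λ x → ⟦ f x ⟧) → IsLinear bounded bounded f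
      ⟦⟧-reflect F = record
        { additive = record
          { f-cong = IsLinear.f-cong F
          ; f-+ = λ x y → V.trans (IsLinear.f-+ F x y) (V.sym (⟦+⟧ _ _)) }
        ; f-* = λ k x → V.trans (IsLinear.f-* F k x) (V.sym (IsLinear.f-* ⟦⟧-linear k _)) }

      linear-resp : ∀ {U W : VSpace a ℓa} {f g} → (∀ x → Module._≈ᴹ_ W (f x) (g x)) → IsLinear U W f → IsLinear U W g
      linear-resp {U} {W} e F = record
        { additive = record
          { f-cong = λ q → W.trans (W.sym (e _)) (W.trans (IsLinear.f-cong F q) (e _))
          ; f-+ = λ x y → W.trans (W.sym (e _)) (W.trans (IsLinear.f-+ F x y) (W.+-cong (e x) (e y))) }
        ; f-* = λ k x → W.trans (W.sym (e _)) (W.trans (IsLinear.f-* F k x) (W.*ₗ-cong W.K-refl (e x))) }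
        where module W = VS W

      op⟦⟧ : ℕ → ℕ × V.Carrier → ℕ × V.Carrier → ℕ × V.Carrier
      op⟦⟧ k x y = proj₁ x ℕ.+ proj₁ y , ⊙ k ⟦ x ⟧ ⟦ y ⟧

      ⟦op⟧ : ∀ k x y → ⟦ op⟦⟧ k x y ⟧ V.≈ ⊙ k ⟦ x ⟧ ⟦ y ⟧
      ⟦op⟧ k x y = p-⊙ (proj₁ x) (proj₁ y) k (proj₂ x) (proj₂ y)

      boundedOps : Ops bounded m
      boundedOps = record
        { ⊙ = op⟦⟧
        ; bilinear = λ k → record
          { linˡ = λ y → ⟦⟧-reflect (linear-resp (λ x → V.sym (⟦op⟧ k x y)) (linear-∘ (O.⊙-linˡ k ⟦ y ⟧) ⟦⟧-linear))
          ; linʳ = λ x → ⟦⟧-reflect (linear-resp (λ y → V.sym (⟦op⟧ k x y)) (linear-∘ (O.⊙-linʳ k ⟦ x ⟧) ⟦⟧-linear)) }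
        ; vanish = λ {k} q x y → V.trans (⟦op⟧ k x y) (V.trans (O.vanish {k} q ⟦ x ⟧ ⟦ y ⟧) (V.sym (IsLinear.f-0 (p.linear 0))))
        ; rel = λ {i} {k} i≤k x y z → begin
            ⟦ op⟦⟧ k (op⟦⟧ i x y) z ⟧            ≈⟨ V.trans (⟦op⟧ k _ z) (O.⊙-cong k (⟦op⟧ i x y) V.refl) ⟩
            ⊙ k (⊙ i ⟦ x ⟧ ⟦ y ⟧) ⟦ z ⟧          ≈⟨ O.rel i≤k _ _ _ ⟩
            ⊙ i ⟦ x ⟧ (⊙ k ⟦ y ⟧ ⟦ z ⟧) V.+ ⊙ k ⟦ x ⟧ (⊙ 0 ⟦ y ⟧ ⟦ z ⟧ V.- ⊙ k ⟦ y ⟧ ⟦ z ⟧)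
              ≈⟨ V.+-cong (V.trans (⟦op⟧ i x _) (O.⊙-cong i V.refl (⟦op⟧ k y z)))
                   (V.trans (⟦op⟧ k x _) (O.⊙-cong k V.refl
                     (V.trans (IsLinear.f-sub ⟦⟧-linear (op⟦⟧ 0 y z) (op⟦⟧ k y z)) (V.sub-cong (⟦op⟧ 0 y z) (⟦op⟧ k y z))))) ⟨
            ⟦ op⟦⟧ i x (op⟦⟧ k y z) ⟧ V.+ ⟦ op⟦⟧ k x (op⟦⟧ 0 y z Bd.+ᴹ Bd.-ᴹ op⟦⟧ k y z) ⟧
              ≈⟨ ⟦+⟧ (op⟦⟧ i x (op⟦⟧ k y z)) (op⟦⟧ k x (op⟦⟧ 0 y z Bd.+ᴹ Bd.-ᴹ op⟦⟧ k y z)) ⟨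
            ⟦ op⟦⟧ i x (op⟦⟧ k y z) Bd.+ᴹ op⟦⟧ k x (op⟦⟧ 0 y z Bd.+ᴹ Bd.-ᴹ op⟦⟧ k y z) ⟧ ∎ }
        where open VS V using (begin_; step-≈-⟩; step-≈-⟨; _∎)

      -- A generator is a tree with one leaf, hence the bound 1.
      θ-ext = extend boundedOps (λ x → 1 , ι x)
      θ : V.Carrier → ℕ × V.Carrier
      θ = proj₁ θ-ext
      module θ = IsOpsHom (proj₁ (proj₂ θ-ext))

      -- The composite D → `bounded` → D is a homomorphism that fixes the generators. This is where
      -- every element of D turns out to be of the form `p n d`.
      ⟦θ⟧ : ∀ d → ⟦ θ d ⟧ V.≈ d
      ⟦θ⟧ = unique O
        (record { linear = linear-∘ ⟦⟧-linear θ.linear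
                ; ⊙-hom = λ k x y → V.trans (θ.⊙-hom k x y) (⟦op⟧ k (θ x) (θ y)) })
        (record { linear = linear-id ; ⊙-hom = λ _ _ _ → V.refl })
        (λ x → V.trans (proj₂ (proj₂ θ-ext) x) (stage-≤ V tr 1 (leaf x) ℕₚ.≤-refl))

    degree : V.Carrier → ℕ
    degree d = proj₁ (θ d)

    p-degree-id : ∀ d → p (degree d) d V.≈ d
    p-degree-id d = V.trans (IsLinear.f-cong (p.linear (degree d)) (V.sym (⟦θ⟧ d))) (V.trans (p-absorb ℕₚ.≤-refl (proj₂ (θ d))) (⟦θ⟧ d))

    module _ {W : VSpace a ℓa} where
      private module W = VS W

      linear-ext : ∀ {f h} → IsLinear V W f → IsLinear V W h → (∀ t → f (tr {0} t) W.≈ h (tr t)) → ∀ d → f d W.≈ h d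
      linear-ext {f} {h} F H e d = begin
        f d                   ≈⟨ IsLinear.f-cong F (p-degree-id d) ⟨
        f (p (degree d) d)    ≈⟨ agree-below n F (linear-∘ H (p.linear n)) (p-degree n H)
                                   (λ t q → W.trans (e t) (IsLinear.f-cong H (V.sym (stage-≤ V tr n t q))))
                                   (λ t q → W.trans (IsLinear.f-cong H (stage-> V tr n t q)) (IsLinear.f-0 H)) d ⟩
        h (p (degree d) d)    ≈⟨ IsLinear.f-cong H (p-degree-id d) ⟩
        h d ∎
        where
        n = degree d
        open VS W using (begin_; step-≈-⟩; step-≈-⟨; _∎)

    module _ (W : VSpace a ℓa) (φ : T 0 → Module.Carrierᴹ W) where
      private
        module W = VS W
        s : ℕ → V.Carrier → W.Carrier
        s n = stage.fun W φ n
        module s n = stage W φ n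

      -- An element fixed by `p (degree d)` sees only trees of size at most `degree d`, so the
      -- stages are constant from there on; this is `stable`.
      basisExt : V.Carrier → W.Carrier
      basisExt d = s (degree d) d

      private
        stable : ∀ {n} d → degree d ≤ n → basisExt d W.≈ s n d
        stable {n} d q = W.sym (W.trans (IsLinear.f-cong (s.linear n) (V.sym (p-degree-id d)))
          (agree-below (degree d) (s.linear n) (s.linear (degree d)) (s.degree (degree d))
            (λ t r → W.trans (stage-≤ W φ n t (ℕₚ.≤-trans r q)) (W.sym (stage-≤ W φ (degree d) t r)))
            (stage-> W φ (degree d)) d))

      basisExt-tr : ∀ t → basisExt (tr t) W.≈ φ t
      basisExt-tr t = W.trans (stable (tr t) (ℕₚ.m≤m⊔n _ (size t))) (stage-≤ W φ _ t (ℕₚ.m≤n⊔m (degree (tr t)) _))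

      basisExt-linear : IsLinear V W basisExt
      basisExt-linear = record
        { additive = record
          -- Equal elements may carry different bounds, so they are compared at the maximum; the
          -- same device handles sums and multiples.
          { f-cong = λ {d} {d′} e → let n = degree d ℕ.⊔ degree d′ in
              W.trans (stable {n} d (ℕₚ.m≤m⊔n _ _))
                (W.trans (IsLinear.f-cong (s.linear n) e) (W.sym (stable {n} d′ (ℕₚ.m≤n⊔m (degree d) _))))
          ; f-+ = λ d d′ → let n = degree (d V.+ d′) ℕ.⊔ (degree d ℕ.⊔ degree d′)
                               r = ℕₚ.m≤n⊔m (degree (d V.+ d′)) (degree d ℕ.⊔ degree d′) in
              W.trans (stable {n} (d V.+ d′) (ℕₚ.m≤m⊔n _ _))
                (W.trans (IsLinear.f-+ (s.linear n) d d′)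
                  (W.sym (W.+-cong (stable {n} d (ℕₚ.≤-trans (ℕₚ.m≤m⊔n _ _) r))
                                   (stable {n} d′ (ℕₚ.≤-trans (ℕₚ.m≤n⊔m (degree d) _) r))))) }
        ; f-* = λ k d → let n = degree (k V.*ₗ d) ℕ.⊔ degree d in
            W.trans (stable {n} (k V.*ₗ d) (ℕₚ.m≤m⊔n _ _))
              (W.trans (IsLinear.f-* (s.linear n) k d)
                (W.sym (W.*ₗ-cong W.K-refl (stable {n} d (ℕₚ.m≤n⊔m (degree (k V.*ₗ d)) _))))) }

-- Compositions and the main theorem

psum : List ℕ → ℕ → ℕ
psum r i = sum (take i r)

psum-mono : ∀ r {i k} → i ≤ k → psum r i ≤ psum r k
psum-mono r z≤n                = z≤n
psum-mono [] (s≤s _)           = z≤n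
psum-mono (p ∷ r) (s≤s i≤k)    = ℕₚ.+-monoʳ-≤ p (psum-mono r i≤k)

psum-all : ∀ r {k} → length r ≤ k → psum r k ≡ sum r
psum-all [] {zero} _          = ≡.refl
psum-all [] {suc _} _         = ≡.refl
psum-all (p ∷ r) (s≤s q)      = ≡.cong (p ℕ.+_) (psum-all r q)

psum-< : ∀ {r} → All (0 <_) r → ∀ {i} → i < length r → psum r i < psum r (suc i)
psum-< {p ∷ r} (q ∷ _) {zero} _          = ≡.subst (0 <_) (≡.sym (ℕₚ.+-identityʳ p)) q
psum-< {p ∷ r} (_ ∷ qs) {suc i} (s≤s lt) = ℕₚ.+-monoʳ-< p (psum-< qs lt)

-- The number of i < length r with psum r i < k.
block : List ℕ → ℕ → ℕ
block [] k            = 0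
block (p ∷ r) zero    = 0
block (p ∷ r) (suc k) = suc (block r (suc k ∸ p))

block-0 : ∀ r → block r 0 ≡ 0
block-0 []      = ≡.refl
block-0 (_ ∷ _) = ≡.refl

block-mono : ∀ r {i k} → i ≤ k → block r i ≤ block r k
block-mono [] _                         = z≤n
block-mono (p ∷ r) {zero} _             = z≤n
block-mono (p ∷ r) {suc i} {suc k} i≤k  = s≤s (block-mono r (ℕₚ.∸-monoˡ-≤ p i≤k))

block-psum : ∀ {r} → All (0 <_) r → ∀ {i} → i ≤ length r → block r (psum r i) ≡ i
block-psum {r} _ {zero} _ = block-0 r
block-psum {suc p ∷ r} (_ ∷ qs) {suc i} (s≤s le) =
  ≡.cong suc (≡.trans (≡.cong (block r) (ℕₚ.m+n∸m≡n p (psum r i))) (block-psum qs le))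

module _ {c ℓ a ℓa} (K : Field c ℓ) (m s : ℕ) (r : List ℕ) (len : length r ≡ suc s) (r>0 : All (0 <_) r)
         (total : sum r ≡ suc m) (X : Set a) (D : DyckStr K m a ℓa) (ι : X → DyckStr.Carrierᴹ D)
         (isDyck : IsDyckAlgebra K D) (free : IsFree K D X ι) where

  open Linear K
  open FreeDyck K D isDyck X ι free
  open Limit K D isDyck X ι free

  private
    R : ℕ → ℕ
    R = psum r

    R-total : ∀ {k} → s < k → R k ≡ suc m
    R-total {k} q = ≡.trans (psum-all r (≡.subst (_≤ k) (≡.sym len) q)) total

    R-large : ∀ {k} → s < k → m < R k
    R-large {k} q = ℕₚ.≤-reflexive (≡.sym (R-total {k} q))

    -- Positivity of the i-th part gives R i < R (i + 1) ≤ R (s + 1) = m + 1.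
    R-small : ∀ {i} → i ≤ s → R i ≤ m
    R-small {i} q = ℕₚ.≤-pred (≡.subst (R i <_) (R-total ℕₚ.≤-refl)
      (ℕₚ.<-≤-trans (psum-< r>0 (≡.subst (i <_) (≡.sym len) (s≤s q))) (psum-mono r (s≤s q))))

    block-R : ∀ {i} → i ≤ s → block r (R i) ≡ i
    block-R {i} q = block-psum r>0 (≡.subst (i ≤_) (≡.sym len) (ℕₚ.m≤n⇒m≤1+n q))

    FD : DyckStr K s a ℓa
    FD = F K s r D

    FOps : Ops V s
    FOps = reindex O R ≡.refl (psum-mono r) R-large

    FD-op : ∀ i x y → DyckStr.op FD i x y V.≈ ⊙ (R (toℕ i)) x y V.- ⊙ (R (suc (toℕ i))) x y
    FD-op i x y = begin
      DyckStr.op FD i x y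
        ≈⟨ DS.sumFrom-cong b n (λ j _ _ → DS.opℕ-tail j x y) ⟩
      DyckStr.sumFrom D b n (λ j → ⊙ j x y V.- ⊙ (suc j) x y)
        ≈⟨ DS.telescope b n (λ j → ⊙ j x y) ⟩
      ⊙ b x y V.- ⊙ (b ℕ.+ n) x y
        ≡⟨ ≡.cong (λ k → ⊙ b x y V.- ⊙ k x y) (ℕₚ.m+[n∸m]≡n (psum-mono r (ℕₚ.n≤1+n (toℕ i)))) ⟩
      ⊙ b x y V.- ⊙ (R (suc (toℕ i))) x y ∎
      where
      module DS = Str D
      b = R (toℕ i)
      n = R (suc (toℕ i)) ∸ b
      open VS V using (begin_; step-≈-⟩; step-≡-⟩; _∎)

    FD-tail : ∀ k x y → Str.tail FD k x y V.≈ ⊙ (R k) x y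
    FD-tail = Str.tail-⊙ FD FOps FD-op

    S : ℕ → Set
    S k = Σ ℕ λ i → i < suc s × R i ≡ k

    S? : ∀ k → Dec (S k)
    S? k = ℕₚ.anyUpTo? (λ i → R i ℕ.≟ k) (suc s)

    abstract
      red : Reduction S 𝕀 X
      red = reduction S S? m 𝕀 X cover complete
        where
        cover : ∀ (i : Fin (suc m)) → (0 < toℕ i × toℕ i ≤ m) ⊎ S (toℕ i)
        cover i with S? (toℕ i)
        ... | yes q = inj₂ q
        ... | no ¬q = inj₁ (ℕₚ.n≢0⇒n>0 (λ e → ¬q (0 , s≤s z≤n , ≡.sym e)) , ℕₚ.≤-pred (Finₚ.toℕ<n i))
        complete : ∀ {k} → S k → Σ (Fin (suc m)) λ i → toℕ i ≡ k
        complete (i , lt , e) = fromℕ< (s≤s (R-small (ℕₚ.≤-pred lt))) , ≡.trans (⊙-fin (R-small (ℕₚ.≤-pred lt))) e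

    module red = Reduction red
    module A* = red.A*
    open red using (I*; ρ*; inc; to; from)

    inc-opD : ∀ i x y → opD (inc i) x y ≡ ⊙ (ρ* i) x y
    inc-opD i x y = ≡.cong (λ k → ⊙ k x y) (red.inc-ρ i)

    κ : red.Y → V.Carrier
    κ y = evD (from (A*.gen (A*.leaf y)))

    module To (B : DyckStr K s a ℓa) (isB : IsDyckAlgebra K B) (f : red.Y → DyckStr.Carrierᴹ B) where
      VB : VSpace a ℓa
      VB = DyckStr.vecSpace B

      module B = VS VB

      OB : Ops VB s
      OB = Str.tailOps B isB

      module OB = Ops OB

      -- The kept ranks are the `R i`, and `block r` sends R i back to i, so the operation of rank R
      -- i acts on `B` as ⊙ᵢ. Monotonicity and the value 0 at 0 are what the relations require of
      -- such a relabelling.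
      BAlg : Alg red.𝕀* a ℓa
      BAlg = algOf K red.𝕀* (block r) (block-0 r) (block-mono r) OB

      ψ : A*.FA → B.Carrier
      ψ = A*.ev BAlg f

      module ψ = A*.IsHom (A*.ev-isHom BAlg f)

      -- Evaluation of integral sums of trees over X: they are rewritten over the new generators and
      -- then evaluated in `B`. Linearity over the field enters only with `basisExt`.
      Ψ : FA → B.Carrier
      Ψ x = ψ (to x)

      Ψ-additive : Additive FAgroup (Module.+ᴹ-abelianGroup VB) Ψ
      Ψ-additive = additive-∘ ψ.additive red.to-additive

      Ψ-hom : ∀ i x y → Ψ (x ⊙⟨ inc i ⟩ y) B.≈ OB.⊙ (block r (ρ* i)) (Ψ x) (Ψ y)
      Ψ-hom i x y = B.trans (ψ.f-cong (red.to-hom i x y)) (ψ.hom i (to x) (to y))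

      g : V.Carrier → B.Carrier
      g = basisExt VB (λ t → Ψ (gen t))

      g-linear : IsLinear V VB g
      g-linear = basisExt-linear VB (λ t → Ψ (gen t))

      module g = IsLinear g-linear

      g-ev : ∀ x → g (evD x) B.≈ Ψ x
      g-ev = additive-ext (Module.+ᴹ-abelianGroup VB) (additive-∘ g.additive evD.additive) Ψ-additive
        (basisExt-tr VB (λ t → Ψ (gen t)))

      -- Both sides are linear in x and in y, so trees suffice by `linear-ext`; on trees `g` is `Ψ`,
      -- which respects the kept operations.
      g-op : ∀ i x y → g (opD (inc i) x y) B.≈ OB.⊙ (block r (ρ* i)) (g x) (g y)
      g-op i x y = linear-ext (linear-∘ g-linear (opD-linˡ (inc i) y)) (linear-∘ (OB.⊙-linˡ b (g y)) g-linear)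
        (λ t → linear-ext (linear-∘ g-linear (opD-linʳ (inc i) (tr t))) (linear-∘ (OB.⊙-linʳ b (g (tr t))) g-linear)
          (λ t′ → begin
            g (opD (inc i) (tr t) (tr t′))            ≈⟨ g.f-cong (evD-⊙ (inc i) t t′) ⟩
            g (evD (gen t ⊙⟨ inc i ⟩ gen t′))         ≈⟨ g-ev (gen t ⊙⟨ inc i ⟩ gen t′) ⟩
            Ψ (gen t ⊙⟨ inc i ⟩ gen t′)               ≈⟨ Ψ-hom i (gen t) (gen t′) ⟩
            OB.⊙ b (Ψ (gen t)) (Ψ (gen t′))           ≈⟨ OB.⊙-cong b (g-ev (gen t)) (g-ev (gen t′)) ⟨
            OB.⊙ b (g (tr t)) (g (tr t′)) ∎) y) x
        where
        b = block r (ρ* i)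
        open VS VB using (begin_; step-≈-⟩; step-≈-⟨; _∎)

      g-⊙ : ∀ {k} → k ≤ s → ∀ x y → g (⊙ (R k) x y) B.≈ OB.⊙ k (g x) (g y)
      g-⊙ {k} q x y = go (red.complete (k , s≤s q , ≡.refl))
        where
        go : (Σ I* λ i → ρ* i ≡ R k) → g (⊙ (R k) x y) B.≈ OB.⊙ k (g x) (g y)
        go (i , e) = B.trans (B.reflexive (≡.cong g (≡.trans (≡.cong (λ k → ⊙ k x y) (≡.sym e)) (≡.sym (inc-opD i x y)))))
          (B.trans (g-op i x y)
            (B.reflexive (≡.cong (λ k → OB.⊙ k (g x) (g y)) (≡.trans (≡.cong (block r) e) (block-R q)))))

      g-hom : Hom K FD B
      g-hom = HomTail.tail-hom K FD B g-linear λ k x y → B.trans (g.f-cong (FD-tail k x y)) (go k x y (ℕₚ.≤-<-connex k s))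
        where
        go : ∀ k x y → k ≤ s ⊎ s < k → g (⊙ (R k) x y) B.≈ OB.⊙ k (g x) (g y)
        go k x y (inj₁ q) = g-⊙ q x y
        go k x y (inj₂ q) = B.trans (g.f-cong (O.vanish (R-large q) x y)) (B.trans g.f-0 (B.sym (OB.vanish q _ _)))

      g-κ : ∀ y → g (κ y) B.≈ f y
      g-κ y = B.trans (g-ev (from (A*.gen (A*.leaf y)))) (ψ.f-cong (red.to-from (A*.gen (A*.leaf y))))

      module _ (h : Hom K FD B) (h-κ : ∀ y → Hom.fun h (κ y) B.≈ f y) where
        private
          module h = IsLinear (HomTail.hom-linear K FD B h)
          hf = Hom.fun h

        h-op : ∀ i x y → hf (opD (inc i) x y) B.≈ OB.⊙ (block r (ρ* i)) (hf x) (hf y)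
        h-op i x y = go (red.sound i)
         where
         open VS VB using (begin_; step-≈-⟩; step-≈-⟨; step-≡-⟩; _∎)
         go : S (ρ* i) → hf (opD (inc i) x y) B.≈ OB.⊙ (block r (ρ* i)) (hf x) (hf y)
         go (k , lt , e) = begin
          hf (opD (inc i) x y)                   ≡⟨ ≡.cong hf (≡.trans (inc-opD i x y) (≡.cong (λ k → ⊙ k x y) (≡.sym e))) ⟩
          hf (⊙ (R k) x y)                       ≈⟨ h.f-cong (FD-tail k x y) ⟨
          hf (Str.tail FD k x y)                 ≈⟨ HomTail.hom-tail K FD B h k x y ⟩
          OB.⊙ k (hf x) (hf y)                   ≡⟨ ≡.cong (λ k → OB.⊙ k (hf x) (hf y))
                                                      (≡.trans (≡.sym (block-R (ℕₚ.≤-pred lt))) (≡.cong (block r) e)) ⟩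
          OB.⊙ (block r (ρ* i)) (hf x) (hf y) ∎

        h-from : ∀ z → hf (evD (from z)) B.≈ ψ z
        h-from = A*.hom-ext BAlg
          (record
            { additive = additive-∘ h.additive (additive-∘ evD.additive red.from-additive)
            ; hom = λ i x y → B.trans
                (h.f-cong (V.trans (evD.f-cong (red.from-hom i x y)) (evD.hom (inc i) (from x) (from y))))
                (h-op i _ _) })
          (A*.ev-isHom BAlg f) h-κ

        -- Every tree over X is `from` of a sum of trees over the new generators, where `h-from`
        -- leaves no choice; `linear-ext` passes from trees to D.
        h-unique : ∀ d → hf d B.≈ g d
        h-unique = linear-ext (HomTail.hom-linear K FD B h) g-linear λ t → begin
          hf (tr t)                      ≈⟨ h.f-cong (evD.f-cong (red.from-to (gen t))) ⟨
          hf (evD (from (to (gen t))))   ≈⟨ h-from (to (gen t)) ⟩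
          Ψ (gen t)                      ≈⟨ g-ev (gen t) ⟨
          g (tr t) ∎
          where open VS VB using (begin_; step-≈-⟩; step-≈-⟨; _∎)

  restriction-isDyck : IsDyckAlgebra K FD
  restriction-isDyck = Str.ops⇒isDyck FD FOps FD-op

  restriction-free : Σ (Set a) λ Y → Σ (Y → DyckStr.Carrierᴹ D) λ κ → IsFree K FD Y κ
  restriction-free = red.Y , κ , λ B isB f → let open To B isB f in g-hom , g-κ , h-unique

theorem5p19 : {c ℓ a ℓa : Level} (K : Field c ℓ) (m s : ℕ) → 1 ≤ m → s ≤ m →
    (r : List ℕ) → length r ≡ suc s → All (0 <_) r → sum r ≡ suc m →
    (X : Set a) (D : DyckStr K m a ℓa) (ι : X → DyckStr.Carrierᴹ D) →
    IsDyckAlgebra K D → IsFree K D X ι →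
    IsDyckAlgebra K (F K s r D) ×
    Σ (Set a) (λ Y → Σ (Y → DyckStr.Carrierᴹ D) (λ κ → IsFree K (F K s r D) Y κ))
theorem5p19 K m s _ _ r len r>0 total X D ι isDyck free =
  restriction-isDyck K m s r len r>0 total X D ι isDyck free ,
  restriction-free K m s r len r>0 total X D ι isDyck free
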